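{- Let $q$ be a prime power, $n\ge1$, $\sigma$ a generator of $\mathrm{Gal}(\mathbb{F}_{q^n}/\mathbb{F}_q)$, and let $L=a_0x+a_1x^{\sigma}+\dots+a_dx^{\sigma^d}\in\mathbb{F}_{q^n}[x]$ have $\sigma$-degree $d\ge1$ and $a_0\neq0$. For $\lambda\in\mathbb{F}_q$ let $n_\lambda$ be the dimension of the eigenspace of $A_L$ with eigenvalue $\lambda$ (so $n_\lambda=0$ if $\lambda$ is not an eigenvalue). Then the number of roots of $P_L$ in $\mathbb{F}_{q^n}$ is $$\sum_{\lambda\in\mathbb{F}_q}\frac{q^{n_\lambda}-1}{q-1},$$ and the number of roots of $L$ in $\mathbb{F}_{q^n}$ is $q^{n_1}$.
   Context: $x^\sigma=x^{q^s}$ for some $s$ with $\gcd(s,n)=1$; for a matrix $M$ over $\mathbb{F}_{q^n}$, $M^{\sigma}$ denotes entrywise application of $\sigma$. For $y\in\mathbb{F}_{q^n}$, $y^{[i]}:=y^{1+\sigma+\dots+\sigma^{i-1}}$ ($y^{[0]}=1$). The projective polynomial associated to $L$ is $P_L(y)=\sum_{i=0}^d a_iy^{[i]}$. The companion matrix $C_L$ is the $d\times d$ matrix with $1$'s on the subdiagonal, last column $(-a_0/a_d,\dots,-a_{d-1}/a_d)^T$, zeros elsewhere, and $A_L:=C_LC_L^{\sigma}\cdots C_L^{\sigma^{n-1}}$. -}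

module Defs where

open import Level using (0ℓ)
open import Data.Nat as ℕ using (ℕ; zero; suc)
open import Data.Nat.Primality using (Prime)
open import Data.Nat.DivMod using (_/_)
open import Data.Fin using (Fin; zero; suc; toℕ; fromℕ; inject₁)
open import Data.Fin.Properties using (_≟_)
open import Data.List using (List; length; filter)
open import Data.List.Membership.Propositional using (_∈_)
open import Data.List.Relation.Unary.Unique.Propositional using (Unique)
open import Data.Product using (Σ; ∃; _×_; _,_)
open import Relation.Nullary using (¬_; does)
open import Relation.Binary.PropositionalEquality using (_≡_; _≢_)
open import Relation.Binary.Definitions using (DecidableEquality)
open import Algebra.Structures using (IsCommutativeRing)
open import Data.Bool using (if_then_else_)

IsPrimePower : ℕ → Set
IsPrimePower q = Σ ℕ λ p → Σ ℕ λ k → Prime p × (1 ℕ.≤ k) × (q ≡ p ℕ.^ k)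

-- (q^m - 1)/(q - 1) ; only used for q ≥ 2 (q a prime power)
gauss : ℕ → ℕ → ℕ
gauss zero m = 0
gauss (suc zero) m = 0
gauss (suc (suc k)) m = ((suc (suc k)) ℕ.^ m ℕ.∸ 1) / suc k

record FiniteField : Set₁ where
  infixl 6 _+_
  infixl 7 _*_
  field
    F        : Set
    _+_ _*_  : F → F → F
    -_       : F → F
    0# 1#    : F
    isCommutativeRing : IsCommutativeRing _≡_ _+_ _*_ -_ 0# 1#
    _⁻¹      : F → F
    inverse  : ∀ x → x ≢ 0# → x * (x ⁻¹) ≡ 1#
    0≢1      : 0# ≢ 1#
    _≟F_     : DecidableEquality F
    elements : List F
    complete : ∀ x → x ∈ elements
    unique   : Unique elements

  card : ℕ
  card = length elements

module FFDefs (K : FiniteField) where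
  open FiniteField K public

  pow : F → ℕ → F
  pow x zero = 1#
  pow x (suc m) = x * pow x m

  iter : (F → F) → ℕ → F → F
  iter f zero x = x
  iter f (suc m) x = f (iter f m x)

  sumF : {k : ℕ} → (Fin k → F) → F
  sumF {zero} f = 0#
  sumF {suc k} f = f zero + sumF (λ i → f (suc i))

  prodF : {k : ℕ} → (Fin k → F) → F
  prodF {zero} f = 1#
  prodF {suc k} f = f zero * prodF (λ i → f (suc i))

  countRoots : (F → F) → ℕ
  countRoots f = length (filter (λ x → f x ≟F 0#) elements)

  -- σ-power: y^{[i]} = y^{1+σ+…+σ^{i-1}} = ∏_{j<i} σ^j(y)
  bracketPow : (F → F) → F → ℕ → F
  bracketPow σ y i = prodF {i} (λ j → iter σ (toℕ j) y)

  linPoly : (F → F) → (d : ℕ) → (Fin (suc d) → F) → F → F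
  linPoly σ d a x = sumF (λ i → a i * iter σ (toℕ i) x)

  projPoly : (F → F) → (d : ℕ) → (Fin (suc d) → F) → F → F
  projPoly σ d a y = sumF (λ i → a i * bracketPow σ y (toℕ i))

  Mat : ℕ → Set
  Mat d = Fin d → Fin d → F

  Vec' : ℕ → Set
  Vec' d = Fin d → F

  _⊗_ : {d : ℕ} → Mat d → Mat d → Mat d
  (M ⊗ N) i j = sumF (λ k → M i k * N k j)

  idMat : {d : ℕ} → Mat d
  idMat i j = if does (i ≟ j) then 1# else 0#

  matPow : {d : ℕ} → (F → F) → ℕ → Mat d → Mat d
  matPow σ m M i j = iter σ m (M i j)

  companion : (d : ℕ) → (Fin (suc (suc d)) → F) → Mat (suc d)
  companion d a i j =
    if does (j ≟ fromℕ d) then - (a (inject₁ i) * (a (fromℕ (suc d)) ⁻¹))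
    else (if does (toℕ i Data.Nat.≟ suc (toℕ j)) then 1# else 0#)
    where import Data.Nat

  prodTwisted : {d : ℕ} → (F → F) → Mat d → ℕ → Mat d
  prodTwisted σ C zero = idMat
  prodTwisted σ C (suc m) = prodTwisted σ C m ⊗ matPow σ m C

  AL : (σ : F → F) → (d : ℕ) → (Fin (suc (suc d)) → F) → (n : ℕ) → Mat (suc d)
  AL σ d a n = prodTwisted σ (companion d a) n

  InEig : {d : ℕ} → Mat d → F → Vec' d → Set
  InEig A λ' v = ∀ i → sumF (λ k → A i k * v k) ≡ λ' * v i

  LinIndep : {d m : ℕ} → (Fin m → Vec' d) → Set
  LinIndep {d} {m} vs =
    ∀ (c : Fin m → F) → (∀ i → sumF (λ j → c j * vs j i) ≡ 0#) → ∀ j → c j ≡ 0#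

  EigDim : {d : ℕ} → Mat d → F → ℕ → Set
  EigDim {d} A λ' m =
    (Σ (Fin m → Vec' d) λ vs → (∀ j → InEig A λ' (vs j)) × LinIndep vs)
    × (∀ (vs : Fin (suc m) → Vec' d) → (∀ j → InEig A λ' (vs j)) → ¬ LinIndep vs)

{-# OPTIONS --safe #-}

-- Let L_μ = Σ aᵢ μ^[i] x^{σⁱ}.  A vector u satisfies u C_L = μ u^σ exactly when
-- uᵢ = μ^[i] σⁱ(x) for a root x of L_μ, and such a u is a left eigenvector of A_L with
-- eigenvalue the norm N(μ).  Conversely w ↦ σ⁻¹(μ⁻¹ w C_L) is semilinear with n-th power
-- the identity on that left eigenspace, so by Galois descent the eigenspace has a basis of
-- such vectors; as left and right eigenspaces have equal dimension, L_μ has q^{n_{N(μ)}} roots.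
-- The case μ = 1 counts the roots of L.  For P_L, count the pairs (μ, x) with x ≠ 0 and
-- L_μ(x) = 0: the substitution y = μ σ(x)/x turns them into pairs (y, x) with P_L(y) = 0,
-- while summing over μ and using that all fibres of the norm over F_q^× have the same size
-- gives the Gaussian sum.
module Submission where

open import Defs
open import Level using (0ℓ)
open import Algebra.Bundles using (CommutativeRing; RawRing)
import Algebra.Properties.CommutativeSemiring.Binomial as Binomial
import Algebra.Properties.Ring as RingProperties
import Algebra.Properties.Semiring.Exp as SemiringExp
import Algebra.Properties.Semiring.Mult as SemiringMult
import Algebra.Properties.Semiring.Sum as SemiringSum
import Algebra.Solver.Ring as RingSolver
open import Algebra.Solver.Ring.AlmostCommutativeRing
  using (AlmostCommutativeRing; fromCommutativeRing; _-Raw-AlmostCommutative⟶_)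
open import Data.Bool using (if_then_else_)
open import Data.Empty using (⊥-elim)
open import Data.Fin using (Fin; zero; suc; toℕ; fromℕ; inject₁; inject≤; punchIn)
open import Data.Fin.Properties
  using (_≟_; any?; toℕ-fromℕ; toℕ-inject₁; toℕ-injective; toℕ<n; fromℕ≢inject₁; inject≤-injective)
open import Data.Fin.Relation.Unary.Top using (view; ‵fromℕ; ‵inject₁)
open import Data.List using (List; []; _∷_; map; filter; foldr; length; cartesianProductWith)
open import Data.List.Properties using (length-++; length-map; map-∘)
open import Data.List.Membership.Propositional using (_∈_; find; lose)
open import Data.List.Membership.Propositional.Properties
  using (∈-map⁺; ∈-map⁻; ∈-filter⁺; ∈-filter⁻; ∈-cartesianProductWith⁺; ∈-cartesianProductWith⁻)
open import Data.List.Membership.Propositional.Properties.WithK using (unique∧set⇒bag)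
open import Data.List.Relation.Binary.BagAndSetEquality using (∼bag⇒↭)
open import Data.List.Relation.Binary.Permutation.Propositional using (_↭_; ↭⇒↭ₛ)
open import Data.List.Relation.Binary.Permutation.Propositional.Properties using (map⁺; ↭-length)
import Data.List.Relation.Binary.Permutation.Setoid.Properties as ↭ₛ
open import Data.List.Relation.Unary.All as All using (All; [])
import Data.List.Relation.Unary.All.Properties as All
open import Data.List.Relation.Unary.AllPairs using ([]; _∷_)
open import Data.List.Relation.Unary.Any as Any using (here; there)
open import Data.List.Relation.Unary.Unique.Propositional using (Unique)
import Data.List.Relation.Unary.Unique.Propositional.Properties as Unique
open import Data.Maybe using (Maybe; just; nothing)
open import Data.Nat as ℕ using (ℕ; zero; suc; _^_; _≤_; z≤n; s≤s; _!)
open import Data.Nat.Combinatorics using (nCn≡1; nCk≡n!/k![n-k]!; k![n∸k]!∣n!) renaming (_C_ to _choose_)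
open import Data.Nat.Coprimality as Coprime using (Coprime; coprime-divisor; coprime-Bézout)
open import Data.Nat.Divisibility using (_∣_; divides; ∣⇒≤; m∣m*n; m%n≡0⇒n∣m)
open import Data.Nat.DivMod using (_%_; _/_; m≡m%n+[m/n]*n; m%n<n; m/n*n≡m; m*n/n≡m)
open import Data.Nat.GCD using (module Bézout)
open import Data.Nat.ListAction using (sum)
open import Data.Nat.ListAction.Properties using (sum-↭)
open import Data.Nat.Primality using (Prime; euclidsLemma; prime⇒nonZero; prime⇒nonTrivial)
import Data.Nat.Properties as ℕₚ
open import Data.Product using (Σ; ∃; _×_; _,_; proj₁; proj₂)
open import Data.Product.Properties using (≡-dec)
open import Data.Sum using (inj₁; inj₂)
open import Data.Unit using (⊤; tt)
open import Data.Vec using (Vec; []; _∷_; lookup; tabulate)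
open import Data.Vec.Properties using (∷-injective; lookup∘tabulate; tabulate∘lookup; tabulate-cong)
open import Data.Vec.Functional using (insertAt)
open import Data.Vec.Functional.Properties using (insertAt-lookup; insertAt-punchIn)
open import Function using (_∘_)
open import Function.Bundles using (mk⇔)
open import Relation.Binary.Definitions using (DecidableEquality)
open import Relation.Binary.PropositionalEquality hiding (resp)
open import Relation.Nullary using (Dec; yes; no; does; ¬_)
open import Relation.Nullary.Decidable using (¬?; map′; decidable-stable; dec-true; dec-false)
open import Relation.Unary using (Pred; Decidable)

-- Two kinds of dimension must be matched: the roots of L_μ form a space over F_q, while `EigDim`
-- counts vectors independent over the whole field. Descent shows that the vectors of an F_q-basis
-- of roots span the left eigenspace; a second semilinear argument, `vec-indep`, shows that they
-- stay independent over the whole field. Row vectors are the natural ones because C shifts them by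
-- one place, so u is determined by its first coordinate and only the last column involves the
-- coefficients of L. The field is known only through a list of its elements of length q^n. Its
-- characteristic, |F_q| = q, the order of σ and the surjectivity of the norm onto F_q^× are
-- therefore extracted from root bounds, permutations of that list and double counting; no generator
-- of the multiplicative group is chosen. The value λ = 0 lies in F_q but is not the norm of any μ ≠
-- 0, so its term is shown to vanish separately. This, and the fact that y = 0 is not a root of P_L,
-- is where a₀ ≠ 0 enters.

-- Indicators and finite sums of natural numbers

𝟙 : ∀ {p} {P : Set p} → Dec P → ℕ
𝟙 d = if does d then 1 else 0

𝟙-yes : ∀ {p} {P : Set p} (d : Dec P) → P → 𝟙 d ≡ 1
𝟙-yes (yes _) _ = refl
𝟙-yes (no ¬p) p = ⊥-elim (¬p p)

𝟙-no : ∀ {p} {P : Set p} (d : Dec P) → ¬ P → 𝟙 d ≡ 0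
𝟙-no (yes p) ¬p = ⊥-elim (¬p p)
𝟙-no (no _) _ = refl

𝟙-⇔ : ∀ {p r} {P : Set p} {R : Set r} (d : Dec P) (e : Dec R) → (P → R) → (R → P) → 𝟙 d ≡ 𝟙 e
𝟙-⇔ (yes p) e f g = sym (𝟙-yes e (f p))
𝟙-⇔ (no ¬p) e f g = sym (𝟙-no e λ r → ¬p (g r))

𝟙-*-cong : ∀ {p} {P : Set p} (d : Dec P) {m n : ℕ} → (P → m ≡ n) → 𝟙 d ℕ.* m ≡ 𝟙 d ℕ.* n
𝟙-*-cong (yes p) h = cong (1 ℕ.*_) (h p)
𝟙-*-cong (no _) h = refl

𝟙-¬ : ∀ {p} {P : Set p} (d : Dec P) → 𝟙 d ℕ.+ 𝟙 (¬? d) ≡ 1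
𝟙-¬ (yes _) = refl
𝟙-¬ (no _) = refl

unique-↭ : {A : Set} {xs ys : List A} → Unique xs → Unique ys →
  (∀ {x} → x ∈ xs → x ∈ ys) → (∀ {x} → x ∈ ys → x ∈ xs) → xs ↭ ys
unique-↭ u v f g = ∼bag⇒↭ (unique∧set⇒bag u v (mk⇔ f g))

module _ {A : Set} where

  ∑ : (A → ℕ) → List A → ℕ
  ∑ f xs = sum (map f xs)

  ∑-cong∈ : ∀ {f g} (xs : List A) → (∀ {x} → x ∈ xs → f x ≡ g x) → ∑ f xs ≡ ∑ g xs
  ∑-cong∈ [] h = refl
  ∑-cong∈ (x ∷ xs) h = cong₂ ℕ._+_ (h (here refl)) (∑-cong∈ xs λ x∈ → h (there x∈))

  ∑-cong : ∀ {f g} (xs : List A) → (∀ x → f x ≡ g x) → ∑ f xs ≡ ∑ g xs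
  ∑-cong xs h = ∑-cong∈ xs λ {x} _ → h x

  ∑-+ : ∀ (f g : A → ℕ) xs → ∑ (λ x → f x ℕ.+ g x) xs ≡ ∑ f xs ℕ.+ ∑ g xs
  ∑-+ f g [] = refl
  ∑-+ f g (x ∷ xs) = begin
    f x ℕ.+ g x ℕ.+ ∑ (λ x → f x ℕ.+ g x) xs  ≡⟨ cong (f x ℕ.+ g x ℕ.+_) (∑-+ f g xs) ⟩
    f x ℕ.+ g x ℕ.+ (∑ f xs ℕ.+ ∑ g xs)       ≡⟨ ℕₚ.+-assoc (f x) (g x) _ ⟩
    f x ℕ.+ (g x ℕ.+ (∑ f xs ℕ.+ ∑ g xs))     ≡⟨ cong (f x ℕ.+_) (ℕₚ.+-assoc (g x) (∑ f xs) _) ⟨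
    f x ℕ.+ (g x ℕ.+ ∑ f xs ℕ.+ ∑ g xs)       ≡⟨ cong (λ z → f x ℕ.+ (z ℕ.+ ∑ g xs)) (ℕₚ.+-comm (g x) _) ⟩
    f x ℕ.+ (∑ f xs ℕ.+ g x ℕ.+ ∑ g xs)       ≡⟨ cong (f x ℕ.+_) (ℕₚ.+-assoc (∑ f xs) (g x) _) ⟩
    f x ℕ.+ (∑ f xs ℕ.+ (g x ℕ.+ ∑ g xs))     ≡⟨ ℕₚ.+-assoc (f x) _ _ ⟨
    f x ℕ.+ ∑ f xs ℕ.+ (g x ℕ.+ ∑ g xs)       ∎
    where open ≡-Reasoning

  ∑-*ˡ : ∀ c (f : A → ℕ) xs → ∑ (λ x → c ℕ.* f x) xs ≡ c ℕ.* ∑ f xs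
  ∑-*ˡ c f [] = sym (ℕₚ.*-zeroʳ c)
  ∑-*ˡ c f (x ∷ xs) =
    trans (cong (c ℕ.* f x ℕ.+_) (∑-*ˡ c f xs)) (sym (ℕₚ.*-distribˡ-+ c (f x) _))

  ∑-*ʳ : ∀ (f : A → ℕ) xs c → ∑ (λ x → f x ℕ.* c) xs ≡ ∑ f xs ℕ.* c
  ∑-*ʳ f xs c = trans (∑-cong xs λ x → ℕₚ.*-comm (f x) c) (trans (∑-*ˡ c f xs) (ℕₚ.*-comm c _))

  ∑-const : ∀ c (xs : List A) → ∑ (λ _ → c) xs ≡ length xs ℕ.* c
  ∑-const c [] = refl
  ∑-const c (x ∷ xs) = cong (c ℕ.+_) (∑-const c xs)

  ∑-↭ : ∀ (f : A → ℕ) {xs ys} → xs ↭ ys → ∑ f xs ≡ ∑ f ys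
  ∑-↭ f p = sum-↭ (map⁺ f p)

  ∑-mono : ∀ {f g} (xs : List A) → (∀ {x} → x ∈ xs → f x ≤ g x) → ∑ f xs ≤ ∑ g xs
  ∑-mono [] h = z≤n
  ∑-mono (x ∷ xs) h = ℕₚ.+-mono-≤ (h (here refl)) (∑-mono xs λ x∈ → h (there x∈))

  ∑-filter : ∀ {p} {P : Pred A p} (P? : Decidable P) (f : A → ℕ) xs →
    ∑ f (filter P? xs) ≡ ∑ (λ x → 𝟙 (P? x) ℕ.* f x) xs
  ∑-filter P? f [] = refl
  ∑-filter P? f (x ∷ xs) with P? x
  ... | yes _ = cong₂ ℕ._+_ (sym (ℕₚ.*-identityˡ (f x))) (∑-filter P? f xs)
  ... | no _ = ∑-filter P? f xs

  length-filter≡∑ : ∀ {p} {P : Pred A p} (P? : Decidable P) xs →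
    length (filter P? xs) ≡ ∑ (λ x → 𝟙 (P? x)) xs
  length-filter≡∑ P? [] = refl
  length-filter≡∑ P? (x ∷ xs) with P? x
  ... | yes _ = cong suc (length-filter≡∑ P? xs)
  ... | no _ = length-filter≡∑ P? xs

  ∑-𝟙-* : (_≟_ : DecidableEquality A) {a : A} (f : A → ℕ) {xs : List A} → Unique xs → a ∈ xs →
    ∑ (λ x → 𝟙 (x ≟ a) ℕ.* f x) xs ≡ f a
  ∑-𝟙-* _≟_ {a} f {x ∷ xs} (x∉ ∷ u) (here refl) = begin
    𝟙 (a ≟ a) ℕ.* f a ℕ.+ ∑ (λ y → 𝟙 (y ≟ a) ℕ.* f y) xs
      ≡⟨ cong₂ ℕ._+_ (cong (ℕ._* f a) (𝟙-yes (a ≟ a) refl))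
           (∑-cong∈ xs λ y∈ → cong (ℕ._* f _) (𝟙-no (_ ≟ a) λ y≡a → All.lookup x∉ y∈ (sym y≡a))) ⟩
    1 ℕ.* f a ℕ.+ ∑ (λ _ → 0) xs  ≡⟨ cong₂ ℕ._+_ (ℕₚ.*-identityˡ (f a)) (trans (∑-const 0 xs) (ℕₚ.*-zeroʳ (length xs))) ⟩
    f a ℕ.+ 0                     ≡⟨ ℕₚ.+-identityʳ (f a) ⟩
    f a                           ∎
    where open ≡-Reasoning
  ∑-𝟙-* _≟_ {a} f {x ∷ xs} (x∉ ∷ u) (there a∈) =
    cong₂ ℕ._+_ (cong (ℕ._* f x) (𝟙-no (x ≟ a) (All.lookup x∉ a∈))) (∑-𝟙-* _≟_ f u a∈)

  -- If any term fell short of the bound, the others could not make up for it. This turns an upper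
  -- bound on each norm fibre plus the total count into the exact size of each.
  ∑-saturated : ∀ {f : A → ℕ} {c} (xs : List A) → (∀ {x} → x ∈ xs → f x ≤ c) →
    ∑ f xs ≡ length xs ℕ.* c → ∀ {x} → x ∈ xs → f x ≡ c
  ∑-saturated {f} {c} (x ∷ xs) le eq = go
    where
    rest≤ : ∑ f xs ≤ length xs ℕ.* c
    rest≤ = subst (∑ f xs ≤_) (∑-const c xs) (∑-mono xs λ x∈ → le (there x∈))
    fx≡c : f x ≡ c
    fx≡c = ℕₚ.≤-antisym (le (here refl))
      (ℕₚ.+-cancelʳ-≤ (length xs ℕ.* c) c (f x)
        (subst (_≤ f x ℕ.+ length xs ℕ.* c) eq (ℕₚ.+-monoʳ-≤ (f x) rest≤)))
    go : ∀ {y} → y ∈ x ∷ xs → f y ≡ c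
    go (here refl) = fx≡c
    go (there y∈) = ∑-saturated xs (λ x∈ → le (there x∈))
      (ℕₚ.+-cancelˡ-≡ c _ _ (trans (cong (ℕ._+ ∑ f xs) (sym fx≡c)) eq)) y∈

∑-swap : {A B : Set} (f : A → B → ℕ) (xs : List A) (ys : List B) →
  ∑ (λ x → ∑ (f x) ys) xs ≡ ∑ (λ y → ∑ (λ x → f x y) xs) ys
∑-swap f [] ys = sym (trans (∑-const 0 ys) (ℕₚ.*-zeroʳ (length ys)))
∑-swap f (x ∷ xs) ys =
  trans (cong (∑ (f x) ys ℕ.+_) (∑-swap f xs ys)) (sym (∑-+ (f x) _ ys))

-- Binomial coefficients modulo a prime

p∤m! : ∀ {p} → Prime p → ∀ m → m ℕ.< p → ¬ (p ∣ m !)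
p∤m! pr zero _ p∣1 = ℕₚ.<⇒≱ (ℕ.nonTrivial⇒n>1 _ {{prime⇒nonTrivial pr}}) (∣⇒≤ p∣1)
p∤m! pr (suc m) m<p p∣ with euclidsLemma (suc m) (m !) pr p∣
... | inj₁ p∣m = ℕₚ.<⇒≱ m<p (∣⇒≤ p∣m)
... | inj₂ p∣m! = p∤m! pr m (ℕₚ.<-trans (ℕₚ.n<1+n m) m<p) p∣m!

-- The product of the binomial coefficient with k! (p - k)! is p!, which p divides; both factorials
-- are products of numbers below p, so p must divide the coefficient.
p∣pCk : ∀ {p} → Prime p → ∀ k → 0 ℕ.< k → k ℕ.< p → p ∣ (p choose k)
p∣pCk {suc p′} pr k 0<k k<p
  with euclidsLemma (p choose k) (k ! ℕ.* (p ℕ.∸ k) !) pr p∣prod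
  where
  p = suc p′
  instance _ = ℕₚ._!*_!≢0 k (p ℕ.∸ k)
  p∣prod : p ∣ (p choose k) ℕ.* (k ! ℕ.* (p ℕ.∸ k) !)
  p∣prod = subst (p ∣_)
    (sym (trans (cong (ℕ._* (k ! ℕ.* (p ℕ.∸ k) !)) (nCk≡n!/k![n-k]! (ℕₚ.<⇒≤ k<p)))
                (m/n*n≡m (k![n∸k]!∣n! (ℕₚ.<⇒≤ k<p)))))
    (m∣m*n (p′ !))
... | inj₁ p∣C = p∣C
... | inj₂ p∣d with euclidsLemma (k !) _ pr p∣d
...   | inj₁ p∣k! = ⊥-elim (p∤m! pr k k<p p∣k!)
...   | inj₂ p∣r! = ⊥-elim (p∤m! pr (suc p′ ℕ.∸ k) (ℕₚ.∸-monoʳ-< 0<k (ℕₚ.<⇒≤ k<p)) p∣r!)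

-- The quotient (q^m - 1)/(q - 1)

-- The sum 1 + q + ... + q^(m-1) for q = `suc k`, by Horner's rule, so that inductions on m need no
-- division.
quotient : ℕ → ℕ → ℕ
quotient k zero = 0
quotient k (suc m) = suc (suc k ℕ.* quotient k m)

quotient-spec : ∀ k m → suc k ℕ.^ m ≡ suc (quotient k m ℕ.* k)
quotient-spec k zero = refl
quotient-spec k (suc m) = begin
  suc k ℕ.* suc k ℕ.^ m              ≡⟨ cong (suc k ℕ.*_) (quotient-spec k m) ⟩
  suc k ℕ.* suc (e ℕ.* k)            ≡⟨ ℕₚ.*-suc (suc k) (e ℕ.* k) ⟩
  suc k ℕ.+ suc k ℕ.* (e ℕ.* k)      ≡⟨ cong (suc k ℕ.+_) (ℕₚ.*-assoc (suc k) e k) ⟨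
  suc (k ℕ.+ suc k ℕ.* e ℕ.* k)      ∎
  where
  open ≡-Reasoning
  e : ℕ
  e = quotient k m

-- The division in `gauss` is exact. In this form q^m splits into the zero vector and `gauss q m`
-- punctured lines of q - 1 vectors each, which is how it is used for the roots of L_μ.
gauss-spec : ∀ {q} → 1 ℕ.< q → ∀ m → q ℕ.^ m ≡ suc (gauss q m ℕ.* ℕ.pred q)
gauss-spec {suc zero} (s≤s ())
gauss-spec {suc (suc k)} _ m = trans (quotient-spec (suc k) m) (cong (λ e → suc (e ℕ.* suc k))
  (sym (trans (cong (λ z → (z ℕ.∸ 1) / suc k) (quotient-spec (suc k) m)) (m*n/n≡m (quotient (suc k) m) (suc k)))))

prime-power>1 : ∀ {q} → IsPrimePower q → 1 ℕ.< q
prime-power>1 (p , k , p-prime , 1≤k , refl) =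
  ℕₚ.^-monoʳ-< p (ℕ.nonTrivial⇒n>1 p {{prime⇒nonTrivial p-prime}}) 1≤k

-- Words over a finite alphabet

module _ {A : Set} where

  -- Coefficient tuples for spans over F_q. They are vectors rather than functions on `Fin r`, so
  -- that tuples with equal entries are equal and the enumeration has no duplicates.
  words : List A → (r : ℕ) → List (Vec A r)
  words xs zero = [] ∷ []
  words xs (suc r) = cartesianProductWith _∷_ xs (words xs r)

  length-words : ∀ xs r → length (words xs r) ≡ length xs ℕ.^ r
  length-words xs zero = refl
  length-words xs (suc r) = trans (go xs) (cong (length xs ℕ.*_) (length-words xs r))
    where
    go : ∀ ys → length (cartesianProductWith _∷_ ys (words xs r)) ≡ length ys ℕ.* length (words xs r)
    go [] = refl
    go (y ∷ ys) = trans (length-++ (map (y ∷_) (words xs r)))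
      (cong₂ ℕ._+_ (length-map (y ∷_) (words xs r)) (go ys))

  words-unique : ∀ {xs} → Unique xs → ∀ r → Unique (words xs r)
  words-unique u zero = [] ∷ []
  words-unique u (suc r) = Unique.cartesianProductWith⁺ _∷_ ∷-injective u (words-unique u r)

  ∈-words⁺ : ∀ {xs r} (c : Vec A r) → (∀ i → lookup c i ∈ xs) → c ∈ words xs r
  ∈-words⁺ [] h = here refl
  ∈-words⁺ (x ∷ c) h = ∈-cartesianProductWith⁺ _∷_ (h zero) (∈-words⁺ c (h ∘ suc))

  ∈-words⁻ : ∀ {xs r} {c : Vec A r} → c ∈ words xs r → ∀ i → lookup c i ∈ xs
  ∈-words⁻ {xs} {suc r} c∈ i with ∈-cartesianProductWith⁻ _∷_ xs (words xs r) c∈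
  ∈-words⁻ {xs} {suc r} c∈ zero | x , c , x∈ , c∈′ , refl = x∈
  ∈-words⁻ {xs} {suc r} c∈ (suc i) | x , c , x∈ , c∈′ , refl = ∈-words⁻ c∈′ i

unique-map : {A B : Set} {f : A → B} {xs : List A} →
  (∀ {x y} → x ∈ xs → y ∈ xs → f x ≡ f y → x ≡ y) → Unique xs → Unique (map f xs)
unique-map inj [] = []
unique-map inj (x∉ ∷ u) =
  All.map⁺ (All.tabulate λ y∈ fx≡fy → All.lookup x∉ y∈ (inj (here refl) (there y∈) fx≡fy))
  ∷ unique-map (λ x∈ y∈ → inj (there x∈) (there y∈)) u

lookup-injective : {A : Set} {r : ℕ} {c c′ : Vec A r} → (∀ i → lookup c i ≡ lookup c′ i) → c ≡ c′
lookup-injective {c = c} {c′} h = trans (sym (tabulate∘lookup c)) (trans (tabulate-cong h) (tabulate∘lookup c′))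

-- The field as a commutative ring, with a solver for its identities

module Field (K : FiniteField) where
  open FFDefs K public

  commutativeRing : CommutativeRing 0ℓ 0ℓ
  commutativeRing = record { isCommutativeRing = isCommutativeRing }

  open CommutativeRing commutativeRing public
    using (+-assoc; +-comm; +-identityˡ; +-identityʳ; -‿inverseˡ; -‿inverseʳ;
           *-assoc; *-comm; *-identityˡ; *-identityʳ; distribˡ; distribʳ; zeroˡ; zeroʳ; +-congˡ; *-congˡ; +-congʳ; *-congʳ; ring; semiring)
  open RingProperties ring public
    using (-‿distribˡ-*; -‿distribʳ-*; -0#≈0#; -‿involutive; x∙y⁻¹≈ε⇒x≈y; x≈y⇒x∙y⁻¹≈ε)
  open SemiringMult semiring public using (×-homo-+; ×1-homo-*) renaming (_×_ to _·_)

  -- Coefficients of the ring solver are formal differences a − b of naturals,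
  -- so that it can decide the cancellations which F itself leaves stuck.
  private
    reduce : ℕ × ℕ → ℕ × ℕ
    reduce (suc a , suc b) = reduce (a , b)
    reduce x = x

    Diff : RawRing 0ℓ 0ℓ
    Diff = record
      { Carrier = ℕ × ℕ
      ; _≈_ = _≡_
      ; _+_ = λ (a , b) (c , d) → reduce (a ℕ.+ c , b ℕ.+ d)
      ; _*_ = λ (a , b) (c , d) → reduce (a ℕ.* c ℕ.+ b ℕ.* d , a ℕ.* d ℕ.+ b ℕ.* c)
      ; -_ = λ (a , b) → b , a
      ; 0# = 0 , 0
      ; 1# = 1 , 0
      }

    almostRing : AlmostCommutativeRing 0ℓ 0ℓ
    almostRing = fromCommutativeRing commutativeRing

    module AR = AlmostCommutativeRing almostRing

    ⟪_⟫ : ℕ × ℕ → F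
    ⟪ a , b ⟫ = a · 1# + - (b · 1#)

    -- Makes the constants 0 and 1 of the solver denote 0# and 1# on the nose.
    ⟦_⟧ᴰ : ℕ × ℕ → F
    ⟦ 0 , 0 ⟧ᴰ = 0#
    ⟦ 1 , 0 ⟧ᴰ = 1#
    ⟦ a , b ⟧ᴰ = ⟪ a , b ⟫

    ⟦⟧≡⟪⟫ : ∀ x → ⟦ x ⟧ᴰ ≡ ⟪ x ⟫
    ⟦⟧≡⟪⟫ (0 , 0) = sym (-‿inverseʳ 0#)
    ⟦⟧≡⟪⟫ (0 , suc b) = refl
    ⟦⟧≡⟪⟫ (1 , 0) = sym (trans (cong₂ _+_ (+-identityʳ 1#) -0#≈0#) (+-identityʳ 1#))
    ⟦⟧≡⟪⟫ (1 , suc b) = refl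
    ⟦⟧≡⟪⟫ (suc (suc a) , 0) = refl
    ⟦⟧≡⟪⟫ (suc (suc a) , suc b) = refl

    swap-middle : ∀ w x y z → (w + x) + (y + z) ≡ (w + y) + (x + z)
    swap-middle w x y z = begin
      (w + x) + (y + z)  ≡⟨ +-assoc w x _ ⟩
      w + (x + (y + z))  ≡⟨ cong (w +_) (+-assoc x y z) ⟨
      w + ((x + y) + z)  ≡⟨ cong (λ t → w + (t + z)) (+-comm x y) ⟩
      w + ((y + x) + z)  ≡⟨ cong (w +_) (+-assoc y x z) ⟩
      w + (y + (x + z))  ≡⟨ +-assoc w y _ ⟨
      (w + y) + (x + z)  ∎
      where open ≡-Reasoning

    neg-* : ∀ x y → - x * - y ≡ x * y
    neg-* x y = trans (sym (-‿distribˡ-* x (- y)))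
      (trans (cong -_ (sym (-‿distribʳ-* x y))) (-‿involutive _))

    expand : ∀ a b c d → (a + - b) * (c + - d) ≡ (a * c + b * d) + - (a * d + b * c)
    expand a b c d = begin
      (a + - b) * (c + - d)                      ≡⟨ distribʳ _ a _ ⟩
      a * (c + - d) + - b * (c + - d)            ≡⟨ cong₂ _+_ (distribˡ a c _) (distribˡ (- b) c _) ⟩
      (a * c + a * - d) + (- b * c + - b * - d)  ≡⟨ cong ((a * c + a * - d) +_) (+-comm _ _) ⟩
      (a * c + a * - d) + (- b * - d + - b * c)  ≡⟨ swap-middle _ _ _ _ ⟩
      (a * c + - b * - d) + (a * - d + - b * c)
        ≡⟨ cong₂ _+_ (cong (a * c +_) (neg-* b d))
                     (cong₂ _+_ (sym (-‿distribʳ-* a d)) (sym (-‿distribˡ-* b c))) ⟩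
      (a * c + b * d) + (- (a * d) + - (b * c))  ≡⟨ cong (_ +_) (AR.-‿+-comm (a * d) (b * c)) ⟩
      (a * c + b * d) + - (a * d + b * c)        ∎
      where open ≡-Reasoning

    ⟪⟫-+ : ∀ a b c d → ⟪ a ℕ.+ c , b ℕ.+ d ⟫ ≡ ⟪ a , b ⟫ + ⟪ c , d ⟫
    ⟪⟫-+ a b c d = trans (cong₂ (λ x y → x + - y) (×-homo-+ 1# a c) (×-homo-+ 1# b d))
      (trans (+-congˡ (sym (AR.-‿+-comm (b · 1#) (d · 1#)))) (swap-middle _ _ _ _))

    ⟪⟫-* : ∀ a b c d → ⟪ a ℕ.* c ℕ.+ b ℕ.* d , a ℕ.* d ℕ.+ b ℕ.* c ⟫ ≡ ⟪ a , b ⟫ * ⟪ c , d ⟫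
    ⟪⟫-* a b c d = trans
      (cong₂ (λ x y → x + - y)
        (trans (×-homo-+ 1# (a ℕ.* c) _) (cong₂ _+_ (×1-homo-* a c) (×1-homo-* b d)))
        (trans (×-homo-+ 1# (a ℕ.* d) _) (cong₂ _+_ (×1-homo-* a d) (×1-homo-* b c))))
      (sym (expand (a · 1#) (b · 1#) (c · 1#) (d · 1#)))

    ⟪⟫-neg : ∀ a b → ⟪ b , a ⟫ ≡ - ⟪ a , b ⟫
    ⟪⟫-neg a b = trans (+-comm _ _)
      (trans (cong (- (a · 1#) +_) (sym (-‿involutive _))) (AR.-‿+-comm (a · 1#) (- (b · 1#))))

    reduce-sound : ∀ a b → ⟪ reduce (a , b) ⟫ ≡ ⟪ a , b ⟫
    reduce-sound zero b = refl
    reduce-sound (suc a) zero = refl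
    reduce-sound (suc a) (suc b) = trans (reduce-sound a b) (trans
      (sym (trans (+-congʳ (-‿inverseʳ 1#)) (+-identityˡ _)))
      (trans (swap-middle _ _ _ _) (+-congˡ (AR.-‿+-comm 1# (b · 1#)))))

    sound : ∀ x → ⟦ reduce x ⟧ᴰ ≡ ⟪ x ⟫
    sound x@(a , b) = trans (⟦⟧≡⟪⟫ (reduce x)) (reduce-sound a b)

    homo : Diff -Raw-AlmostCommutative⟶ almostRing
    homo = record
      { ⟦_⟧ = ⟦_⟧ᴰ
      ; +-homo = λ x@(a , b) y@(c , d) → trans (sound (a ℕ.+ c , b ℕ.+ d))
          (trans (⟪⟫-+ a b c d) (sym (cong₂ _+_ (⟦⟧≡⟪⟫ x) (⟦⟧≡⟪⟫ y))))
      ; *-homo = λ x@(a , b) y@(c , d) → trans (sound (a ℕ.* c ℕ.+ b ℕ.* d , a ℕ.* d ℕ.+ b ℕ.* c))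
          (trans (⟪⟫-* a b c d) (sym (cong₂ _*_ (⟦⟧≡⟪⟫ x) (⟦⟧≡⟪⟫ y))))
      ; -‿homo = λ x@(a , b) → trans (⟦⟧≡⟪⟫ (b , a)) (trans (⟪⟫-neg a b) (cong -_ (sym (⟦⟧≡⟪⟫ x))))
      ; 0-homo = refl
      ; 1-homo = refl
      }

    diff≟ : (x y : ℕ × ℕ) → Maybe (⟦ x ⟧ᴰ ≡ ⟦ y ⟧ᴰ)
    diff≟ x y with ≡-dec ℕ._≟_ ℕ._≟_ x y
    ... | no _ = nothing
    ... | yes eq = just (cong ⟦_⟧ᴰ eq)

  open RingSolver Diff almostRing homo diff≟ public
    using (solve; _:=_; _:+_; _:*_; _:-_; :-_; con)

  -- Inverses and cancellation

  inverseˡ : ∀ {x} → x ≢ 0# → x ⁻¹ * x ≡ 1#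
  inverseˡ x≢0 = trans (*-comm _ _) (inverse _ x≢0)

  *-cancelˡ : ∀ {z x y} → z ≢ 0# → z * x ≡ z * y → x ≡ y
  *-cancelˡ {z} {x} {y} z≢0 eq = begin
    x                ≡⟨ *-identityˡ x ⟨
    1# * x           ≡⟨ cong (_* x) (inverseˡ z≢0) ⟨
    z ⁻¹ * z * x     ≡⟨ *-assoc _ _ _ ⟩
    z ⁻¹ * (z * x)   ≡⟨ cong (z ⁻¹ *_) eq ⟩
    z ⁻¹ * (z * y)   ≡⟨ *-assoc _ _ _ ⟨
    z ⁻¹ * z * y     ≡⟨ cong (_* y) (inverseˡ z≢0) ⟩
    1# * y           ≡⟨ *-identityˡ y ⟩
    y                ∎
    where open ≡-Reasoning

  x*y≡0⇒y≡0 : ∀ {x y} → x ≢ 0# → x * y ≡ 0# → y ≡ 0#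
  x*y≡0⇒y≡0 x≢0 eq = *-cancelˡ x≢0 (trans eq (sym (zeroʳ _)))

  *-≢0 : ∀ {x y} → x ≢ 0# → y ≢ 0# → x * y ≢ 0#
  *-≢0 x≢0 y≢0 eq = y≢0 (x*y≡0⇒y≡0 x≢0 eq)

  ⁻¹-≢0 : ∀ {x} → x ≢ 0# → x ⁻¹ ≢ 0#
  ⁻¹-≢0 x≢0 eq = 0≢1 (trans (sym (zeroʳ _)) (trans (*-congˡ (sym eq)) (inverse _ x≢0)))

  1≢0 : 1# ≢ 0#
  1≢0 eq = 0≢1 (sym eq)

  x-y≡0⇒x≡y : ∀ {x y} → x + - y ≡ 0# → x ≡ y
  x-y≡0⇒x≡y = x∙y⁻¹≈ε⇒x≈y _ _

  x≡y⇒x-y≡0 : ∀ {x y} → x ≡ y → x + - y ≡ 0#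
  x≡y⇒x-y≡0 = x≈y⇒x∙y⁻¹≈ε

  +-cancelʳ : ∀ {x y} z → x + z ≡ y + z → x ≡ y
  +-cancelʳ {x} {y} z eq = begin
    x            ≡⟨ solve 2 (λ x z → x := (x :+ z) :- z) refl x z ⟩
    x + z + - z  ≡⟨ cong (_+ - z) eq ⟩
    y + z + - z  ≡⟨ solve 2 (λ x z → (x :+ z) :- z := x) refl y z ⟩
    y            ∎
    where open ≡-Reasoning

  -- Finite sums and products

  sumF-cong : ∀ {k} {f g : Fin k → F} → (∀ i → f i ≡ g i) → sumF f ≡ sumF g
  sumF-cong {zero} h = refl
  sumF-cong {suc k} h = cong₂ _+_ (h zero) (sumF-cong (h ∘ suc))

  sumF-0 : ∀ k → sumF {k} (λ _ → 0#) ≡ 0#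
  sumF-0 zero = refl
  sumF-0 (suc k) = trans (+-identityˡ _) (sumF-0 k)

  sumF-+ : ∀ {k} (f g : Fin k → F) → sumF (λ i → f i + g i) ≡ sumF f + sumF g
  sumF-+ {zero} f g = sym (+-identityˡ 0#)
  sumF-+ {suc k} f g = trans (+-congˡ (sumF-+ (f ∘ suc) (g ∘ suc)))
    (solve 4 (λ a b c d → (a :+ b) :+ (c :+ d) := (a :+ c) :+ (b :+ d)) refl _ _ _ _)

  sumF-*ˡ : ∀ {k} c (f : Fin k → F) → sumF (λ i → c * f i) ≡ c * sumF f
  sumF-*ˡ {zero} c f = sym (zeroʳ c)
  sumF-*ˡ {suc k} c f = trans (+-congˡ (sumF-*ˡ c (f ∘ suc))) (sym (distribˡ c _ _))

  sumF-*ʳ : ∀ {k} (f : Fin k → F) c → sumF (λ i → f i * c) ≡ sumF f * c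
  sumF-*ʳ f c = trans (sumF-cong λ i → *-comm (f i) c) (trans (sumF-*ˡ c f) (*-comm c _))

  sumF-neg : ∀ {k} (f : Fin k → F) → sumF (λ i → - f i) ≡ - sumF f
  sumF-neg {zero} f = sym -0#≈0#
  sumF-neg {suc k} f = trans (+-congˡ (sumF-neg (f ∘ suc)))
    (solve 2 (λ a b → :- a :+ :- b := :- (a :+ b)) refl _ _)

  sumF-swap : ∀ {k l} (f : Fin k → Fin l → F) →
    sumF (λ i → sumF (f i)) ≡ sumF (λ j → sumF (λ i → f i j))
  sumF-swap {zero} {l} f = sym (sumF-0 l)
  sumF-swap {suc k} f = trans (+-congˡ (sumF-swap (f ∘ suc))) (sym (sumF-+ (f zero) (λ j → sumF (λ i → f (suc i) j))))

  sumF-last : ∀ {k} (f : Fin (suc k) → F) → sumF f ≡ sumF (f ∘ inject₁) + f (fromℕ k)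
  sumF-last {zero} f = +-comm _ _
  sumF-last {suc k} f = trans (+-congˡ (sumF-last (f ∘ suc))) (sym (+-assoc _ _ _))

  sumF-punchIn : ∀ {k} (j : Fin (suc k)) (f : Fin (suc k) → F) →
    sumF f ≡ f j + sumF (f ∘ punchIn j)
  sumF-punchIn zero f = refl
  sumF-punchIn {suc k} (suc j) f = trans (+-congˡ (sumF-punchIn j (f ∘ suc)))
    (solve 3 (λ a b c → a :+ (b :+ c) := b :+ (a :+ c)) refl _ _ _)

  prodF-cong : ∀ {k} {f g : Fin k → F} → (∀ i → f i ≡ g i) → prodF f ≡ prodF g
  prodF-cong {zero} h = refl
  prodF-cong {suc k} h = cong₂ _*_ (h zero) (prodF-cong (h ∘ suc))

  prodF-last : ∀ {k} (f : Fin (suc k) → F) → prodF f ≡ prodF (f ∘ inject₁) * f (fromℕ k)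
  prodF-last {zero} f = *-comm _ _
  prodF-last {suc k} f = trans (*-congˡ (prodF-last (f ∘ suc))) (sym (*-assoc _ _ _))

  -- Powers and iterates

  pow-1 : ∀ x → pow x 1 ≡ x
  pow-1 = *-identityʳ

  1-pow : ∀ m → pow 1# m ≡ 1#
  1-pow zero = refl
  1-pow (suc m) = trans (*-identityˡ _) (1-pow m)

  0-pow : ∀ m → 0 ℕ.< m → pow 0# m ≡ 0#
  0-pow (suc m) _ = zeroˡ _

  pow-distrib-* : ∀ x y m → pow (x * y) m ≡ pow x m * pow y m
  pow-distrib-* x y zero = sym (*-identityˡ 1#)
  pow-distrib-* x y (suc m) = trans (*-congˡ (pow-distrib-* x y m))
    (solve 4 (λ a b c d → (a :* b) :* (c :* d) := (a :* c) :* (b :* d)) refl _ _ _ _)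

  pow-+ : ∀ x m n → pow x (m ℕ.+ n) ≡ pow x m * pow x n
  pow-+ x zero n = sym (*-identityˡ _)
  pow-+ x (suc m) n = trans (cong (x *_) (pow-+ x m n)) (sym (*-assoc _ _ _))

  pow-* : ∀ x m n → pow x (m ℕ.* n) ≡ pow (pow x m) n
  pow-* x m zero = cong (pow x) (ℕₚ.*-zeroʳ m)
  pow-* x m (suc n) = trans (cong (pow x) (ℕₚ.*-suc m n))
    (trans (pow-+ x m _) (cong (pow x m *_) (pow-* x m n)))

  pow-≢0 : ∀ {x} m → x ≢ 0# → pow x m ≢ 0#
  pow-≢0 zero x≢0 = 1≢0
  pow-≢0 (suc m) x≢0 = *-≢0 x≢0 (pow-≢0 m x≢0)

  iter-pow : ∀ m k x → iter (λ y → pow y m) k x ≡ pow x (m ℕ.^ k)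
  iter-pow m zero x = sym (pow-1 x)
  iter-pow m (suc k) x = trans (cong (λ y → pow y m) (iter-pow m k x))
    (trans (sym (pow-* x (m ℕ.^ k) m)) (cong (pow x) (ℕₚ.*-comm (m ℕ.^ k) m)))

  iter-+ : ∀ (f : F → F) k l x → iter f (k ℕ.+ l) x ≡ iter f k (iter f l x)
  iter-+ f zero l x = refl
  iter-+ f (suc k) l x = cong f (iter-+ f k l x)

  iter-suc : ∀ (f : F → F) k x → iter f (suc k) x ≡ iter f k (f x)
  iter-suc f zero x = refl
  iter-suc f (suc k) x = cong f (iter-suc f k x)

  iter-* : ∀ (f : F → F) k l x → iter f (k ℕ.* l) x ≡ iter (iter f l) k x
  iter-* f zero l x = refl
  iter-* f (suc k) l x = trans (iter-+ f l (k ℕ.* l) x) (cong (iter f l) (iter-* f k l x))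

  iter-fixed : ∀ {f : F → F} {x} → f x ≡ x → ∀ k → iter f k x ≡ x
  iter-fixed eq zero = refl
  iter-fixed {f} eq (suc k) = trans (cong f (iter-fixed eq k)) eq

  -- Fermat's little theorem and the characteristic

  private
    module CR = CommutativeRing commutativeRing

    mult-↭ : ∀ {xs ys} → xs ↭ ys → foldr _*_ 1# xs ≡ foldr _*_ 1# ys
    mult-↭ p = ↭ₛ.foldr-commMonoid (setoid F) CR.*-isCommutativeMonoid (↭⇒↭ₛ p)

    add-↭ : ∀ {xs ys} → xs ↭ ys → foldr _+_ 0# xs ≡ foldr _+_ 0# ys
    add-↭ p = ↭ₛ.foldr-commMonoid (setoid F) CR.+-isCommutativeMonoid (↭⇒↭ₛ p)

  elements-↭ : ∀ (f g : F → F) → (∀ x → f (g x) ≡ x) → (∀ x → g (f x) ≡ x) → map f elements ↭ elements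
  elements-↭ f g fg gf = unique-↭ (Unique.map⁺ (λ {x} {y} eq → trans (sym (gf x)) (trans (cong g eq) (gf y))) unique) unique
    (λ _ → complete _)
    (λ {x} _ → subst (_∈ map f elements) (fg x) (∈-map⁺ f (complete (g x))))

  units : List F
  units = filter (λ x → ¬? (x ≟F 0#)) elements

  ∈units⇒≢0 : ∀ {x} → x ∈ units → x ≢ 0#
  ∈units⇒≢0 x∈ = proj₂ (∈-filter⁻ (λ x → ¬? (x ≟F 0#)) {xs = elements} x∈)

  ≢0⇒∈units : ∀ {x} → x ≢ 0# → x ∈ units
  ≢0⇒∈units x≢0 = ∈-filter⁺ (λ x → ¬? (x ≟F 0#)) (complete _) x≢0

  units-unique : Unique units
  units-unique = Unique.filter⁺ (λ x → ¬? (x ≟F 0#)) unique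

  units-↭ : ∀ {x} → x ≢ 0# → map (x *_) units ↭ units
  units-↭ {x} x≢0 = unique-↭ (Unique.map⁺ (*-cancelˡ x≢0) units-unique) units-unique to from
    where
    to : ∀ {y} → y ∈ map (x *_) units → y ∈ units
    to y∈ with ∈-map⁻ (x *_) y∈
    ... | z , z∈ , refl = ≢0⇒∈units (*-≢0 x≢0 (∈units⇒≢0 z∈))
    from : ∀ {y} → y ∈ units → y ∈ map (x *_) units
    from {y} y∈ = subst (_∈ map (x *_) units)
      (trans (sym (*-assoc _ _ _)) (trans (cong (_* y) (inverse x x≢0)) (*-identityˡ y)))
      (∈-map⁺ (x *_) (≢0⇒∈units (*-≢0 (⁻¹-≢0 x≢0) (∈units⇒≢0 y∈))))

  nonzero? : ∀ x → Dec (x ≢ 0#)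
  nonzero? x = ¬? (x ≟F 0#)

  length≡1+nonzero : ∀ {xs} → Unique xs → 0# ∈ xs → length xs ≡ suc (length (filter nonzero? xs))
  length≡1+nonzero {xs} xs-unique 0∈xs = begin
    length xs                                                  ≡⟨ ℕₚ.*-identityʳ _ ⟨
    length xs ℕ.* 1                                            ≡⟨ ∑-const 1 xs ⟨
    ∑ (λ _ → 1) xs                                             ≡⟨ ∑-cong xs (λ x → sym (𝟙-¬ (x ≟F 0#))) ⟩
    ∑ (λ x → 𝟙 (x ≟F 0#) ℕ.+ 𝟙 (nonzero? x)) xs                ≡⟨ ∑-+ _ _ xs ⟩
    ∑ (λ x → 𝟙 (x ≟F 0#)) xs ℕ.+ ∑ (λ x → 𝟙 (nonzero? x)) xs
      ≡⟨ cong₂ ℕ._+_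
           (trans (∑-cong xs λ x → sym (ℕₚ.*-identityʳ _)) (∑-𝟙-* _≟F_ (λ _ → 1) xs-unique 0∈xs))
           (sym (length-filter≡∑ nonzero? xs)) ⟩
    suc (length (filter nonzero? xs))                          ∎
    where open ≡-Reasoning

  card≡1+units : card ≡ suc (length units)
  card≡1+units = length≡1+nonzero unique (complete 0#)

  -- Multiplication by x permutes the units, so their product P satisfies x^m P = P, where m is the
  -- number of units; P is nonzero and cancels.
  fermat : ∀ {x} → x ≢ 0# → pow x (length units) ≡ 1#
  fermat {x} x≢0 = *-cancelˡ (product≢0 units ∈units⇒≢0) (begin
    foldr _*_ 1# units * pow x (length units)  ≡⟨ *-comm _ _ ⟩
    pow x (length units) * foldr _*_ 1# units  ≡⟨ product-map units ⟨
    foldr _*_ 1# (map (x *_) units)            ≡⟨ mult-↭ (units-↭ x≢0) ⟩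
    foldr _*_ 1# units                         ≡⟨ *-identityʳ _ ⟨
    foldr _*_ 1# units * 1#                    ∎)
    where
    open ≡-Reasoning
    product≢0 : ∀ xs → (∀ {y} → y ∈ xs → y ≢ 0#) → foldr _*_ 1# xs ≢ 0#
    product≢0 [] h = 1≢0
    product≢0 (y ∷ xs) h = *-≢0 (h (here refl)) (product≢0 xs (h ∘ there))
    product-map : ∀ xs → foldr _*_ 1# (map (x *_) xs) ≡ pow x (length xs) * foldr _*_ 1# xs
    product-map [] = sym (*-identityˡ 1#)
    product-map (y ∷ xs) = trans (cong (x * y *_) (product-map xs))
      (solve 4 (λ a b c d → (a :* b) :* (c :* d) := (a :* c) :* (b :* d)) refl _ _ _ _)

  pow-card : ∀ x → pow x card ≡ x
  pow-card x with x ≟F 0#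
  ... | yes refl = 0-pow card (subst (0 ℕ.<_) (sym card≡1+units) (s≤s z≤n))
  ... | no x≢0 = trans (cong (pow x) card≡1+units) (trans (cong (x *_) (fermat x≢0)) (*-identityʳ x))

  -- The additive analogue of `fermat`: translation by 1 permutes the field, so the sum of all
  -- elements is unchanged when 1 is added `card` times.
  card·1≡0 : card · 1# ≡ 0#
  card·1≡0 = +-cancelʳ (foldr _+_ 0# elements) (begin
    card · 1# + foldr _+_ 0# elements   ≡⟨ sum-map elements ⟨
    foldr _+_ 0# (map (1# +_) elements) ≡⟨ add-↭ (elements-↭ (1# +_) (- 1# +_) (λ x → cancel 1# x) λ x → cancel′ 1# x) ⟩
    foldr _+_ 0# elements               ≡⟨ +-identityˡ _ ⟨
    0# + foldr _+_ 0# elements          ∎)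
    where
    open ≡-Reasoning
    cancel : ∀ a x → a + (- a + x) ≡ x
    cancel = solve 2 (λ a x → a :+ (:- a :+ x) := x) refl
    cancel′ : ∀ a x → - a + (a + x) ≡ x
    cancel′ = solve 2 (λ a x → :- a :+ (a :+ x) := x) refl
    sum-map : ∀ xs → foldr _+_ 0# (map (1# +_) xs) ≡ length xs · 1# + foldr _+_ 0# xs
    sum-map [] = sym (+-identityˡ 0#)
    sum-map (y ∷ xs) = trans (cong (1# + y +_) (sum-map xs))
      (solve 4 (λ a b c d → (a :+ b) :+ (c :+ d) := (a :+ c) :+ (b :+ d)) refl _ _ _ _)

  ^-·1 : ∀ m k → (m ℕ.^ k) · 1# ≡ pow (m · 1#) k
  ^-·1 m zero = +-identityʳ 1#
  ^-·1 m (suc k) = trans (×1-homo-* m (m ℕ.^ k)) (cong (m · 1# *_) (^-·1 m k))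

  pow≡0⇒≡0 : ∀ {x} m → pow x m ≡ 0# → x ≡ 0#
  pow≡0⇒≡0 {x} m eq with x ≟F 0#
  ... | yes x≡0 = x≡0
  ... | no x≢0 = ⊥-elim (pow-≢0 m x≢0 eq)

  module _ {p} (p·1≡0 : p · 1# ≡ 0#) (p-prime : Prime p) where
    private
      open SemiringExp semiring using () renaming (_^_ to _^ᶠ_)
      open SemiringSum semiring using () renaming (sum to Sum; sum-init-last to Sum-init-last; sum-cong-≗ to Sum-cong; sum-replicate-zero to Sum-0)
      open SemiringMult semiring using (×-congʳ; ×-assoc-*)
      open Binomial CR.commutativeSemiring using (binomialTerm; binomialExpansion) renaming (theorem to binomial-theorem)

      pow≡^ : ∀ x m → pow x m ≡ x ^ᶠ m
      pow≡^ x zero = refl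
      pow≡^ x (suc m) = cong (x *_) (pow≡^ x m)

    multiple·x≡0 : ∀ {m} → p ∣ m → ∀ x → m · x ≡ 0#
    multiple·x≡0 (divides k refl) x = begin
      (k ℕ.* p) · x              ≡⟨ ×-congʳ (k ℕ.* p) (*-identityˡ x) ⟨
      (k ℕ.* p) · (1# * x)       ≡⟨ ×-assoc-* (k ℕ.* p) 1# x ⟨
      ((k ℕ.* p) · 1#) * x       ≡⟨ cong (_* x) (×1-homo-* k p) ⟩
      k · 1# * (p · 1#) * x      ≡⟨ cong (λ z → k · 1# * z * x) p·1≡0 ⟩
      k · 1# * 0# * x            ≡⟨ cong (_* x) (zeroʳ _) ⟩
      0# * x                     ≡⟨ zeroˡ x ⟩
      0#                         ∎
      where open ≡-Reasoning

    freshman : ∀ x y → pow (x + y) p ≡ pow x p + pow y p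
    -- Replacing p by `suc m` exposes the first and last binomial terms; all terms between them have
    -- coefficients divisible by p.
    freshman x y = go p refl
      where
      open ≡-Reasoning
      go : ∀ m → p ≡ m → pow (x + y) m ≡ pow x m + pow y m
      go zero eq = ⊥-elim (ℕ.≢-nonZero⁻¹ p {{prime⇒nonZero p-prime}} eq)
      go (suc m) refl = begin
        pow (x + y) p         ≡⟨ pow≡^ (x + y) p ⟩
        (x + y) ^ᶠ p           ≡⟨ binomial-theorem p x y ⟩
        t zero + Sum (t ∘ suc)
          ≡⟨ cong (t zero +_) (Sum-init-last (t ∘ suc)) ⟩
        t zero + (Sum (t ∘ suc ∘ inject₁) + t (suc (fromℕ m)))
          ≡⟨ cong₂ (λ u v → u + (v + t (suc (fromℕ m)))) t-first (trans (Sum-cong {n = m} t-mid) (Sum-0 m)) ⟩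
        y ^ᶠ p + (0# + t (suc (fromℕ m)))
          ≡⟨ cong (λ u → y ^ᶠ p + (0# + u)) t-last ⟩
        y ^ᶠ p + (0# + x ^ᶠ p)  ≡⟨ trans (cong (y ^ᶠ p +_) (+-identityˡ _)) (+-comm _ _) ⟩
        x ^ᶠ p + y ^ᶠ p         ≡⟨ cong₂ _+_ (pow≡^ x p) (pow≡^ y p) ⟨
        pow x p + pow y p     ∎
        where
        t : Fin (suc p) → F
        t = binomialTerm x y p
        t-first : t zero ≡ y ^ᶠ p
        t-first = trans (+-identityʳ _) (*-identityˡ _)
        t-last : t (suc (fromℕ m)) ≡ x ^ᶠ p
        t-last = begin
          (p choose suc (toℕ (fromℕ m))) · (x ^ᶠ suc (toℕ (fromℕ m)) * y ^ᶠ (m ℕ.∸ toℕ (fromℕ m)))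
            ≡⟨ cong (λ k → (p choose suc k) · (x ^ᶠ suc k * y ^ᶠ (m ℕ.∸ k))) (toℕ-fromℕ m) ⟩
          (p choose p) · (x ^ᶠ p * y ^ᶠ (m ℕ.∸ m))
            ≡⟨ cong₂ (λ k l → k · (x ^ᶠ p * y ^ᶠ l)) (nCn≡1 p) (ℕₚ.n∸n≡0 m) ⟩
          x ^ᶠ p * 1# + 0#   ≡⟨ trans (+-identityʳ _) (*-identityʳ _) ⟩
          x ^ᶠ p             ∎
        t-mid : ∀ i → t (suc (inject₁ i)) ≡ 0#
        t-mid i = multiple·x≡0 (p∣pCk p-prime _ (s≤s z≤n)
          (s≤s (subst (ℕ._< m) (sym (toℕ-inject₁ i)) (toℕ<n i)))) _

    freshman^ : ∀ k x y → pow (x + y) (p ℕ.^ k) ≡ pow x (p ℕ.^ k) + pow y (p ℕ.^ k)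
    freshman^ zero x y = trans (pow-1 _) (sym (cong₂ _+_ (pow-1 x) (pow-1 y)))
    freshman^ (suc k) x y = begin
      pow (x + y) (p ℕ.* p ℕ.^ k)                        ≡⟨ pow-* _ p _ ⟩
      pow (pow (x + y) p) (p ℕ.^ k)                      ≡⟨ cong (λ z → pow z (p ℕ.^ k)) (freshman x y) ⟩
      pow (pow x p + pow y p) (p ℕ.^ k)                  ≡⟨ freshman^ k _ _ ⟩
      pow (pow x p) (p ℕ.^ k) + pow (pow y p) (p ℕ.^ k)  ≡⟨ cong₂ _+_ (pow-* x p _) (pow-* y p _) ⟨
      pow x (p ℕ.* p ℕ.^ k) + pow y (p ℕ.* p ℕ.^ k)      ∎
      where open ≡-Reasoning

  -- Polynomial functions and the subfield F_q

  -- Monic polynomials in Horner form, seen only through their functions: each `step` adds a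
  -- constant coefficient, and the innermost `one` is the leading coefficient. Degree and values are
  -- all that a bound on the number of roots requires.
  data Monic : ℕ → (F → F) → Set where
    one  : ∀ {f} → (∀ x → f x ≡ 1#) → Monic 0 f
    step : ∀ {k f} (c : F) (g : F → F) → Monic k g → (∀ x → f x ≡ c + x * g x) → Monic (suc k) f

  -- Synthetic division: if f = c + x g and g has quotient h at a, then f has quotient g(a) + x h,
  -- which is again in Horner form.
  divide : ∀ {k f} → Monic (suc k) f → ∀ a →
    ∃ λ h → Monic k h × (∀ x → f x ≡ f a + (x + - a) * h x)
  divide {zero} {f} (step c g (one g≡1) f≡) a = (λ _ → 1#) , one (λ _ → refl) , λ x → begin
    f x                         ≡⟨ trans (f≡ x) (cong (λ z → c + x * z) (g≡1 x)) ⟩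
    c + x * 1#                  ≡⟨ solve 4 (λ c x a u → c :+ x :* u := (c :+ a :* u) :+ (x :- a) :* u) refl c x a 1# ⟩
    c + a * 1# + (x + - a) * 1# ≡⟨ cong (_+ (x + - a) * 1#) (trans (f≡ a) (cong (λ z → c + a * z) (g≡1 a))) ⟨
    f a + (x + - a) * 1#        ∎
    where open ≡-Reasoning
  divide {suc k} {f} (step c g m f≡) a with divide m a
  ... | h , mh , g≡ = (λ x → g a + x * h x) , step (g a) h mh (λ _ → refl) , λ x → begin
    f x                                          ≡⟨ trans (f≡ x) (cong (λ z → c + x * z) (g≡ x)) ⟩
    c + x * (g a + (x + - a) * h x)
      ≡⟨ solve 5 (λ c x a u v → c :+ x :* (u :+ (x :- a) :* v) := (c :+ a :* u) :+ (x :- a) :* (u :+ x :* v))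
           refl c x a (g a) (h x) ⟩
    c + a * g a + (x + - a) * (g a + x * h x)    ≡⟨ cong (_+ (x + - a) * (g a + x * h x)) (f≡ a) ⟨
    f a + (x + - a) * (g a + x * h x)            ∎
    where open ≡-Reasoning

  -- Divide by x - a for the first root a. Any other root makes x - a nonzero, hence is a root of
  -- the quotient, whose degree is one less.
  #roots≤degree : ∀ {k f} → Monic k f → ∀ xs → Unique xs → (∀ {x} → x ∈ xs → f x ≡ 0#) → length xs ≤ k
  #roots≤degree m [] u r = z≤n
  #roots≤degree (one f≡1) (a ∷ xs) u r = ⊥-elim (1≢0 (trans (sym (f≡1 a)) (r (here refl))))
  #roots≤degree {f = f} m@(step _ _ _ _) (a ∷ xs) (a∉ ∷ u) r with divide m a
  ... | h , mh , f≡ = s≤s (#roots≤degree mh xs u λ {x} x∈ →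
    x*y≡0⇒y≡0 (λ x-a≡0 → All.lookup a∉ x∈ (sym (x-y≡0⇒x≡y x-a≡0)))
      (begin
        (x + - a) * h x        ≡⟨ +-identityˡ _ ⟨
        0# + (x + - a) * h x   ≡⟨ cong (_+ (x + - a) * h x) (r (here refl)) ⟨
        f a + (x + - a) * h x  ≡⟨ f≡ x ⟨
        f x                    ≡⟨ r (there x∈) ⟩
        0#                     ∎))
    where open ≡-Reasoning

  pow*-monic : ∀ i {j g} → Monic j g → Monic (i ℕ.+ j) (λ x → pow x i * g x)
  pow*-monic zero (one g≡1) = one λ x → trans (*-identityˡ _) (g≡1 x)
  pow*-monic zero (step c g m f≡) = step c g m λ x → trans (*-identityˡ _) (f≡ x)
  pow*-monic (suc i) m = step 0# _ (pow*-monic i m) λ x → trans (*-assoc _ _ _) (sym (+-identityˡ _))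

  pow-minus-id-monic : ∀ m → 1 ℕ.< m → Monic m (λ x → pow x m + - x)
  pow-minus-id-monic (suc zero) (s≤s ())
  pow-minus-id-monic (suc (suc m)) _ = subst (λ k → Monic k (λ x → pow x (2 ℕ.+ m) + - x)) (ℕₚ.+-identityʳ _)
    (step 0# _ (step (- 1#) _ (pow*-monic m {g = λ _ → 1#} (one λ _ → refl)) λ _ → refl)
      λ x → solve 2 (λ x p → x :* (x :* p) :- x := con (0 , 0) :+ x :* (:- con (1 , 0) :+ x :* (p :* con (1 , 0)))) refl x (pow x m))

  geometric : F → ℕ → F
  geometric z zero = 0#
  geometric z (suc e) = 1# + z * geometric z e

  -- This is (z - 1)(1 + z + ... + z^(e-1)) = z^e - 1, with the negative terms moved across.
  geometric-telescopes : ∀ z e → z * geometric z e + 1# ≡ geometric z e + pow z e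
  geometric-telescopes z zero = +-congʳ (zeroʳ z)
  geometric-telescopes z (suc e) = begin
    z * (1# + z * g) + 1#      ≡⟨ cong (λ u → z * u + 1#) (trans (+-comm _ _) (geometric-telescopes z e)) ⟩
    z * (g + pow z e) + 1#     ≡⟨ solve 4 (λ z g p u → z :* (g :+ p) :+ u := (u :+ z :* g) :+ z :* p) refl z g (pow z e) 1# ⟩
    1# + z * g + z * pow z e   ∎
    where
    open ≡-Reasoning
    g : F
    g = geometric z e

  geometric-monic : ∀ k e → Monic (e ℕ.* suc k) (λ x → geometric (pow x (suc k)) (suc e))
  geometric-monic k zero = one λ x → trans (+-congˡ (zeroʳ _)) (+-identityʳ 1#)
  geometric-monic k (suc e) = step 1# _ (pow*-monic k (geometric-monic k e)) λ x → +-congˡ (*-assoc _ _ _)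

  -- The subfield F_q and the powers of Frobenius

  module Subfield (q n : ℕ) (1<q : 1 ℕ.< q) (1≤n : 1 ≤ n) (card≡ : card ≡ q ℕ.^ n) where

    InFq : F → Set
    InFq x = pow x q ≡ x

    inFq? : ∀ x → Dec (InFq x)
    inFq? x = pow x q ≟F x

    Fq : List F
    Fq = filter inFq? elements

    0<q : 0 ℕ.< q
    0<q = ℕₚ.<-trans (s≤s z≤n) 1<q

    instance
      q-nonZero : ℕ.NonZero q
      q-nonZero = ℕ.>-nonZero 0<q

      n-nonZero : ℕ.NonZero n
      n-nonZero = ℕ.>-nonZero 1≤n

    0∈Fq : InFq 0#
    0∈Fq = 0-pow q 0<q

    1∈Fq : InFq 1#
    1∈Fq = 1-pow q

    *∈Fq : ∀ {x y} → InFq x → InFq y → InFq (x * y)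
    *∈Fq {x} {y} hx hy = trans (pow-distrib-* x y q) (cong₂ _*_ hx hy)

    private
      -- For z = x^(q-1), the polynomial x^(q^n-1) - 1 factors as z - 1 times a geometric sum in z.
      -- A nonzero x outside F_q is a root of the left side but not of z - 1, so it is a root of the
      -- sum. That sum has degree q^n - q, which leaves at least q elements for F_q.
      q≤#Fq : q ≤ length Fq
      q≤#Fq = go q n refl refl 1<q 1≤n
        where
        go : ∀ q′ n′ → q ≡ q′ → n ≡ n′ → 1 ℕ.< q′ → 1 ≤ n′ → q ≤ length Fq
        go (suc zero) _ _ _ (s≤s ()) _
        go (suc (suc k₀)) (suc n₀) refl refl _ _ = ℕₚ.+-cancelʳ-≤ (length others) q (length Fq)
          (subst (q ℕ.+ length others ≤_) (sym partition)
            (ℕₚ.+-monoʳ-≤ q (#roots≤degree (geometric-monic k₀ e) others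
              (Unique.filter⁺ (¬? ∘ inFq?) unique) others-roots)))
          where
          k = suc k₀
          -- With k = q - 1 this gives 1 + e = (q^n - 1)/(q - 1), hence e k = q^n - q.
          e = q ℕ.* quotient k n₀
          others : List F
          others = filter (¬? ∘ inFq?) elements
          partition : length Fq ℕ.+ length others ≡ q ℕ.+ e ℕ.* k
          partition = begin
            length Fq ℕ.+ length others
              ≡⟨ cong₂ ℕ._+_ (length-filter≡∑ inFq? elements) (length-filter≡∑ (¬? ∘ inFq?) elements) ⟩
            ∑ (𝟙 ∘ inFq?) elements ℕ.+ ∑ (λ x → 𝟙 (¬? (inFq? x))) elements
              ≡⟨ ∑-+ _ _ elements ⟨
            ∑ (λ x → 𝟙 (inFq? x) ℕ.+ 𝟙 (¬? (inFq? x))) elements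
              ≡⟨ ∑-cong elements (𝟙-¬ ∘ inFq?) ⟩
            ∑ (λ _ → 1) elements    ≡⟨ trans (∑-const 1 elements) (ℕₚ.*-identityʳ _) ⟩
            card                    ≡⟨ trans card≡ (quotient-spec k (suc n₀)) ⟩
            suc (k ℕ.+ e ℕ.* k)     ∎
            where open ≡-Reasoning
          #units : length units ≡ k ℕ.* suc e
          #units = trans (ℕₚ.suc-injective (trans (sym card≡1+units) (trans card≡ (quotient-spec k (suc n₀)))))
                         (ℕₚ.*-comm (suc e) k)
          others-roots : ∀ {x} → x ∈ others → geometric (pow x k) (suc e) ≡ 0#
          others-roots {x} x∈ = x*y≡0⇒y≡0 z≢1 (begin
            (z + - 1#) * g        ≡⟨ solve 3 (λ z u g → (z :- u) :* g := (z :* g :+ u) :- (u :* g :+ u)) refl z 1# g ⟩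
            z * g + 1# + - (1# * g + 1#)
              ≡⟨ cong₂ (λ u v → u + - (v + 1#)) (geometric-telescopes z (suc e)) (*-identityˡ g) ⟩
            g + pow z (suc e) + - (g + 1#)
              ≡⟨ cong (λ u → g + u + - (g + 1#))
                   (trans (sym (pow-* x k (suc e))) (trans (cong (pow x) (sym #units)) (fermat x≢0))) ⟩
            g + 1# + - (g + 1#)   ≡⟨ -‿inverseʳ _ ⟩
            0#                    ∎)
            where
            open ≡-Reasoning
            z = pow x k
            g = geometric z (suc e)
            x∉Fq : ¬ InFq x
            x∉Fq = proj₂ (∈-filter⁻ (¬? ∘ inFq?) {xs = elements} x∈)
            x≢0 : x ≢ 0#
            x≢0 refl = x∉Fq 0∈Fq
            z≢1 : z + - 1# ≢ 0#
            z≢1 z-1≡0 = x∉Fq (trans (cong (x *_) (x-y≡0⇒x≡y z-1≡0)) (*-identityʳ x))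

    #Fq≡q : length Fq ≡ q
    #Fq≡q = ℕₚ.≤-antisym
      (#roots≤degree (pow-minus-id-monic q 1<q) Fq (Unique.filter⁺ inFq? unique)
        λ x∈ → x≡y⇒x-y≡0 (proj₂ (∈-filter⁻ inFq? {xs = elements} x∈)))
      q≤#Fq

    φ : F → F
    φ x = pow x q

    φ^n : ∀ x → iter φ n x ≡ x
    φ^n x = trans (iter-pow q n x) (trans (cong (pow x) (sym card≡)) (pow-card x))

    φ^-% : ∀ m x → iter φ m x ≡ iter φ (m % n) x
    φ^-% m x = begin
      iter φ m x                                  ≡⟨ cong (λ k → iter φ k x) (m≡m%n+[m/n]*n m n) ⟩
      iter φ (m % n ℕ.+ m / n ℕ.* n) x            ≡⟨ iter-+ φ (m % n) _ x ⟩
      iter φ (m % n) (iter φ (m / n ℕ.* n) x)     ≡⟨ cong (iter φ (m % n)) (trans (iter-* φ (m / n) n x) (iter-fixed (φ^n x) (m / n))) ⟩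
      iter φ (m % n) x                            ∎
      where open ≡-Reasoning

    -- Otherwise all q^n elements would be roots of x^(q^r) - x, whose degree is smaller.
    φ^r≢id : ∀ r → 0 ℕ.< r → r ℕ.< n → ¬ (∀ x → iter φ r x ≡ x)
    φ^r≢id r 0<r r<n id = ℕₚ.<⇒≱ (ℕₚ.^-monoʳ-< q 1<q r<n)
      (subst (_≤ q ℕ.^ r) card≡ (#roots≤degree (pow-minus-id-monic (q ℕ.^ r) 1<q^r) elements unique
        λ {x} _ → x≡y⇒x-y≡0 (trans (sym (iter-pow q r x)) (id x))))
      where
      1<q^r : 1 ℕ.< q ℕ.^ r
      1<q^r = ℕₚ.^-monoʳ-< q 1<q 0<r

    -- The interface through which σ is used from here on, free of the exponent s. `σ-moves`
    -- supplies the witnesses for Dedekind's argument, and the last two fields identify the fixed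
    -- field with F_q.
    record GaloisGenerator (σ : F → F) : Set where
      field
        σ-+ : ∀ x y → σ (x + y) ≡ σ x + σ y
        σ-* : ∀ x y → σ (x * y) ≡ σ x * σ y
        σ-1 : σ 1# ≡ 1#
        σ^n : ∀ x → iter σ n x ≡ x
        σ-moves : ∀ k → 0 ℕ.< k → k ℕ.< n → ∃ λ b → iter σ k b ≢ b
        fixed⇒Fq : ∀ {x} → σ x ≡ x → InFq x
        Fq⇒fixed : ∀ {x} → InFq x → σ x ≡ x

    module _ (s : ℕ) (s⊥n : Coprime s n) (σ-additive : ∀ x y → pow (x + y) (q ℕ.^ s) ≡ pow x (q ℕ.^ s) + pow y (q ℕ.^ s)) where
      private
        σ : F → F
        σ x = pow x (q ℕ.^ s)

        σ≡φ^s : ∀ x → σ x ≡ iter φ s x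
        σ≡φ^s x = sym (iter-pow q s x)

        iter-cong : ∀ {f g : F → F} → (∀ x → f x ≡ g x) → ∀ k x → iter f k x ≡ iter g k x
        iter-cong h zero x = refl
        iter-cong {f} h (suc k) x = trans (cong f (iter-cong h k x)) (h _)

        σ^k≡φ^ks : ∀ k x → iter σ k x ≡ iter φ (k ℕ.* s) x
        σ^k≡φ^ks k x = trans (iter-cong σ≡φ^s k x) (sym (iter-* φ k s x))

        σ^n≡id : ∀ x → iter σ n x ≡ x
        σ^n≡id x = trans (σ^k≡φ^ks n x) (trans (cong (λ m → iter φ m x) (ℕₚ.*-comm n s))
          (trans (iter-* φ s n x) (iter-fixed (φ^n x) s)))

        moves : ∀ k → 0 ℕ.< k → k ℕ.< n → ∃ λ b → iter σ k b ≢ b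
        moves k 0<k k<n with All.all? (λ b → iter σ k b ≟F b) elements
        ... | no ¬all with find (All.¬All⇒Any¬ (λ b → iter σ k b ≟F b) elements ¬all)
        ...   | b , _ , moved = b , moved
        -- If σ^k fixed everything, so would φ^(ks mod n). This exponent is below n and is not 0:
        -- otherwise n divides ks, and by coprimality it divides k < n.
        moves k 0<k k<n | yes all = ⊥-elim (φ^r≢id ((k ℕ.* s) % n) 0<r (m%n<n (k ℕ.* s) n)
          λ x → trans (sym (φ^-% (k ℕ.* s) x)) (trans (sym (σ^k≡φ^ks k x)) (All.lookup all (complete x))))
          where
          0<r : 0 ℕ.< (k ℕ.* s) % n
          0<r with (k ℕ.* s) % n in eq
          ... | suc _ = s≤s z≤n
          ... | zero = ⊥-elim (ℕₚ.<⇒≱ k<n (∣⇒≤ {{ℕ.>-nonZero 0<k}}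
            (coprime-divisor (Coprime.sym s⊥n) (subst (n ∣_) (ℕₚ.*-comm k s) (m%n≡0⇒n∣m (k ℕ.* s) n eq)))))

        fixed : ∀ {x} → σ x ≡ x → φ x ≡ x
        -- Bézout makes φ either a power of σ or the inverse of one, depending on the sign pattern;
        -- both fix whatever σ fixes.
        fixed {x} σx≡x with coprime-Bézout s⊥n
        ... | Bézout.+- a b eq = begin
          φ x                           ≡⟨ cong φ (trans (iter-* φ b n x) (iter-fixed (φ^n x) b)) ⟨
          iter φ (suc (b ℕ.* n)) x      ≡⟨ cong (λ m → iter φ m x) eq ⟩
          iter φ (a ℕ.* s) x            ≡⟨ σ^k≡φ^ks a x ⟨
          iter σ a x                    ≡⟨ iter-fixed σx≡x a ⟩
          x                             ∎
          where open ≡-Reasoning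
        ... | Bézout.-+ a b eq = begin
          φ x                           ≡⟨ cong φ (iter-fixed σx≡x a) ⟨
          φ (iter σ a x)                ≡⟨ cong φ (σ^k≡φ^ks a x) ⟩
          iter φ (suc (a ℕ.* s)) x      ≡⟨ cong (λ m → iter φ m x) eq ⟩
          iter φ (b ℕ.* n) x            ≡⟨ trans (iter-* φ b n x) (iter-fixed (φ^n x) b) ⟩
          x                             ∎
          where open ≡-Reasoning

      frobenius-generator : GaloisGenerator σ
      frobenius-generator = record
        { σ-+ = σ-additive
        ; σ-* = λ x y → pow-distrib-* x y (q ℕ.^ s)
        ; σ-1 = 1-pow (q ℕ.^ s)
        ; σ^n = σ^n≡id
        ; σ-moves = moves
        ; fixed⇒Fq = fixed
        ; Fq⇒fixed = λ {x} φx≡x → trans (σ≡φ^s x) (iter-fixed φx≡x s)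
        }

  -- The characteristic is read off from `card·1≡0`: with q = p^k, the element (p · 1)^(kn) is
  -- `card` · 1 = 0, and a field has no nonzero nilpotents.
  prime-power-freshman : ∀ {q n} → IsPrimePower q → card ≡ q ℕ.^ n →
    ∀ s x y → pow (x + y) (q ℕ.^ s) ≡ pow x (q ℕ.^ s) + pow y (q ℕ.^ s)
  prime-power-freshman {q} {n} (p , k , p-prime , _ , refl) card≡ s x y =
    subst (λ m → pow (x + y) m ≡ pow x m + pow y m) (sym (ℕₚ.^-*-assoc p k s))
      (freshman^ p·1≡0 p-prime (k ℕ.* s) x y)
    where
    p·1≡0 : p · 1# ≡ 0#
    p·1≡0 = pow≡0⇒≡0 k (pow≡0⇒≡0 n (begin
      pow (pow (p · 1#) k) n     ≡⟨ cong (λ z → pow z n) (^-·1 p k) ⟨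
      pow ((p ℕ.^ k) · 1#) n     ≡⟨ ^-·1 (p ℕ.^ k) n ⟨
      ((p ℕ.^ k) ℕ.^ n) · 1#     ≡⟨ cong (_· 1#) card≡ ⟨
      card · 1#                  ≡⟨ card·1≡0 ⟩
      0#                         ∎))
      where open ≡-Reasoning

  -- Linear algebra

  idMat-diag : ∀ {d} (i : Fin d) → idMat i i ≡ 1#
  idMat-diag i = cong (if_then 1# else 0#) (dec-true (i ≟ i) refl)

  idMat-injection : ∀ {d e} (f : Fin d → Fin e) → (∀ {i j} → f i ≡ f j → i ≡ j) →
    ∀ i j → idMat (f i) (f j) ≡ idMat i j
  idMat-injection f f-inj i j with i ≟ j
  ... | yes refl = idMat-diag (f i)
  ... | no i≢j = cong (if_then 1# else 0#) (dec-false (f i ≟ f j) (i≢j ∘ f-inj))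

  sumF-*idMat : ∀ {d} (c : Fin d → F) j → sumF (λ i → c i * idMat i j) ≡ c j
  sumF-*idMat {suc d} c zero = begin
    c zero * 1# + sumF (λ i → c (suc i) * 0#)  ≡⟨ cong₂ _+_ (*-identityʳ _) (sumF-cong (λ i → zeroʳ (c (suc i)))) ⟩
    c zero + sumF {d} (λ _ → 0#)               ≡⟨ trans (+-congˡ (sumF-0 d)) (+-identityʳ _) ⟩
    c zero                                     ∎
    where open ≡-Reasoning
  sumF-*idMat {suc d} c (suc j) = trans (+-congʳ (zeroʳ _)) (trans (+-identityˡ _) (sumF-*idMat (c ∘ suc) j))

  idMat-sym : ∀ {d} (i j : Fin d) → idMat i j ≡ idMat j i
  idMat-sym i j with i ≟ j
  ... | yes refl = sym (idMat-diag i)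
  ... | no i≢j = sym (cong (if_then 1# else 0#) (dec-false (j ≟ i) (i≢j ∘ sym)))

  sumF-idMat* : ∀ {d} (c : Fin d → F) i → sumF (λ j → idMat i j * c j) ≡ c i
  sumF-idMat* c i = trans (sumF-cong λ j → trans (*-comm _ _) (*-congˡ (idMat-sym i j))) (sumF-*idMat c i)

  sumF-assoc : ∀ {k l} (u : Fin k → F) (B : Fin k → Fin l → F) (v : Fin l → F) →
    sumF (λ c → sumF (λ i → u i * B i c) * v c) ≡ sumF (λ i → u i * sumF (λ c → B i c * v c))
  sumF-assoc {l = l} u B v = begin
    sumF (λ c → sumF (λ i → u i * B i c) * v c)    ≡⟨ sumF-cong (λ c → sym (sumF-*ʳ (λ i → u i * B i c) (v c))) ⟩
    sumF (λ c → sumF (λ i → u i * B i c * v c))    ≡⟨ sumF-swap (λ c i → u i * B i c * v c) ⟩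
    sumF (λ i → sumF (λ c → u i * B i c * v c))    ≡⟨ sumF-cong (λ i → trans (sumF-cong {l} λ c → *-assoc _ _ _) (sumF-*ˡ (u i) (λ c → B i c * v c))) ⟩
    sumF (λ i → u i * sumF (λ c → B i c * v c))    ∎
    where open ≡-Reasoning

  dot-comm : ∀ {k} (u v : Fin k → F) → sumF (λ i → u i * v i) ≡ sumF (λ i → v i * u i)
  dot-comm u v = sumF-cong λ i → *-comm (u i) (v i)

  sumF-zero : ∀ {k} {f : Fin k → F} → (∀ i → f i ≡ 0#) → sumF f ≡ 0#
  sumF-zero {k} h = trans (sumF-cong h) (sumF-0 k)

  -- Null vectors on both sides stand in for the rank: if a k by l matrix has r independent left
  -- null vectors, its right null space has dimension at least l - (k - r). This is the content of
  -- `right-null-family`.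
  LeftNull : ∀ {k l} → (Fin k → Fin l → F) → Vec' k → Set
  LeftNull B u = ∀ c → sumF (λ i → u i * B i c) ≡ 0#

  RightNull : ∀ {k l} → (Fin k → Fin l → F) → Vec' l → Set
  RightNull B v = ∀ i → sumF (λ c → B i c * v c) ≡ 0#

  combine : ∀ {m r d} → (Fin m → Fin r → F) → (Fin r → Vec' d) → Fin m → Vec' d
  combine M vs i x = sumF (λ j → M i j * vs j x)

  combine-indep : ∀ {m r d} {M : Fin m → Fin r → F} {vs : Fin r → Vec' d} →
    LinIndep M → LinIndep vs → LinIndep (combine M vs)
  combine-indep {M = M} {vs} M-ind vs-ind c rel =
    M-ind c (vs-ind _ λ x → trans (sumF-assoc c M (λ j → vs j x)) (rel x))

  LeftNull-combine : ∀ {m r k l} (M : Fin m → Fin r → F) {us : Fin r → Vec' k} (B : Fin k → Fin l → F) →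
    (∀ j → LeftNull B (us j)) → ∀ i → LeftNull B (combine M us i)
  LeftNull-combine M {us} B null i c = trans (sumF-assoc (M i) us (λ x → B x c))
    (sumF-zero λ j → trans (*-congˡ (null j c)) (zeroʳ _))

  RightNull-combine : ∀ {m r k l} (M : Fin m → Fin r → F) {vs : Fin r → Vec' l} (B : Fin k → Fin l → F) →
    (∀ j → RightNull B (vs j)) → ∀ i → RightNull B (combine M vs i)
  RightNull-combine M {vs} B null i x = trans (dot-comm (B x) (combine M vs i))
    (LeftNull-combine M {vs} (λ c x → B x c) (λ j x → trans (dot-comm (vs j) (B x)) (null j x)) i x)

  -- If φ vanishes, any t coordinate vectors do. Otherwise, for a pivot j₀ with φ j₀ ≠ 0, the
  -- vectors φ(j₀) e_i - φ(i) e_j₀ lie in the kernel; away from j₀ they form a nonzero multiple of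
  -- the identity, so they are independent. Scaling by φ(j₀) avoids division.
  kernel-of-functional : ∀ t (φ : Fin (suc t) → F) →
    Σ (Fin t → Fin (suc t) → F) λ M → LinIndep M × (∀ i → sumF (λ j → M i j * φ j) ≡ 0#)
  kernel-of-functional t φ with any? (λ j → ¬? (φ j ≟F 0#))
  ... | no φ≡0 = (λ i j → idMat (suc i) j)
      , (λ c rel j → trans (sym (sumF-*idMat c j)) (rel (suc j)))
      , λ i → trans (sumF-idMat* φ (suc i)) (decidable-stable (φ (suc i) ≟F 0#) λ φ≢0 → φ≡0 (suc i , φ≢0))
  ... | yes (j₀ , φj₀≢0) = M
      , (λ c rel i → x*y≡0⇒y≡0 φj₀≢0 (begin
          φ j₀ * c i                                        ≡⟨ cong (φ j₀ *_) (sumF-*idMat c i) ⟨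
          φ j₀ * sumF (λ i′ → c i′ * idMat i′ i)            ≡⟨ sumF-*ˡ (φ j₀) (λ i′ → c i′ * idMat i′ i) ⟨
          sumF (λ i′ → φ j₀ * (c i′ * idMat i′ i))
            ≡⟨ sumF-cong (λ i′ → trans (solve 3 (λ a b d → a :* (b :* d) := b :* (a :* d)) refl _ _ _)
                 (*-congˡ (sym (M-off i′ i)))) ⟩
          sumF (λ i′ → c i′ * M i′ (punchIn j₀ i))          ≡⟨ rel (punchIn j₀ i) ⟩
          0#                                                ∎))
      , λ i → begin
          sumF (λ j → M i j * φ j)      ≡⟨ sumF-punchIn j₀ (λ j → M i j * φ j) ⟩
          M i j₀ * φ j₀ + sumF (λ i′ → M i (punchIn j₀ i′) * φ (punchIn j₀ i′))
            ≡⟨ cong₂ _+_ (*-congʳ (M-at i)) (sumF-cong λ i′ → trans (*-congʳ (M-off i i′)) (*-assoc _ _ _)) ⟩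
          - φ (punchIn j₀ i) * φ j₀ + sumF (λ i′ → φ j₀ * (idMat i i′ * φ (punchIn j₀ i′)))
            ≡⟨ +-congˡ (trans (sumF-*ˡ (φ j₀) (λ i′ → idMat i i′ * φ (punchIn j₀ i′))) (*-congˡ (sumF-idMat* (φ ∘ punchIn j₀) i))) ⟩
          - φ (punchIn j₀ i) * φ j₀ + φ j₀ * φ (punchIn j₀ i)
            ≡⟨ solve 2 (λ a b → :- a :* b :+ b :* a := con (0 , 0)) refl _ _ ⟩
          0#                            ∎
      where
      open ≡-Reasoning
      M : Fin t → Fin (suc t) → F
      M i = insertAt (λ i′ → φ j₀ * idMat i i′) j₀ (- φ (punchIn j₀ i))
      M-at : ∀ i → M i j₀ ≡ - φ (punchIn j₀ i)
      M-at i = insertAt-lookup (λ i′ → φ j₀ * idMat i i′) j₀ _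
      M-off : ∀ i i′ → M i (punchIn j₀ i′) ≡ φ j₀ * idMat i i′
      M-off i i′ = insertAt-punchIn (λ i′ → φ j₀ * idMat i i′) j₀ _ i′

  unit-vectors-indep : ∀ {d e} (f : Fin d → Fin e) → (∀ {i j} → f i ≡ f j → i ≡ j) → LinIndep (λ j → idMat (f j))
  unit-vectors-indep f f-inj c rel j = begin
    c j                                       ≡⟨ sumF-*idMat c j ⟨
    sumF (λ i → c i * idMat i j)              ≡⟨ sumF-cong (λ i → cong (c i *_) (sym (idMat-injection f f-inj i j))) ⟩
    sumF (λ i → c i * idMat (f i) (f j))      ≡⟨ rel (f j) ⟩
    0#                                        ∎
    where open ≡-Reasoning

  -- Induction on the number of rows: row 0 either occurs in some left relation,
  -- and is then redundant, or in none, and then costs one dimension of solutions.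
  right-null-family : ∀ k {l r t} (B : Fin k → Fin l → F) (us : Fin r → Vec' k) →
    LinIndep us → (∀ j → LeftNull B (us j)) → k ℕ.+ t ≤ r ℕ.+ l →
    Σ (Fin t → Vec' l) λ vs → LinIndep vs × (∀ j → RightNull B (vs j))
  -- In the zero-dimensional space every relation holds, so a nonempty family is never independent.
  right-null-family zero {r = suc r} B us ind null le = ⊥-elim (1≢0 (ind (λ _ → 1#) (λ ()) zero))
  right-null-family zero {r = zero} B us ind null t≤l =
    (λ j → idMat (inject≤ j t≤l)) , unit-vectors-indep _ (inject≤-injective t≤l t≤l _ _) , λ j ()
  right-null-family (suc k) {l} {r} {t} B us ind null le with any? (λ j → ¬? (us j zero ≟F 0#))
  ... | no u₀≡0 =
    let zeros = λ j → decidable-stable (us j zero ≟F 0#) λ u₀≢0 → u₀≡0 (j , u₀≢0)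
        vs , vs-ind , vs-null = right-null-family k (B ∘ suc) (λ j → us j ∘ suc)
          (λ c rel → ind c λ { zero → sumF-zero (λ j → trans (*-congˡ (zeros j)) (zeroʳ _)) ; (suc x) → rel x })
          (λ j c → trans (sym (trans (+-congʳ (trans (*-congʳ (zeros j)) (zeroˡ _))) (+-identityˡ _))) (null j c))
          (subst (_≤ r ℕ.+ l) (sym (ℕₚ.+-suc k t)) le)
        M , M-ind , M-null = kernel-of-functional t (λ j → sumF (λ c → B zero c * vs j c))
    in combine M vs , combine-indep {M = M} {vs} M-ind vs-ind , λ i → λ
      { zero → trans (dot-comm (B zero) (combine M vs i)) (trans (sumF-assoc (M i) vs (B zero))
          (trans (sumF-cong λ j → cong (M i j *_) (dot-comm (vs j) (B zero))) (M-null i)))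
      ; (suc x) → RightNull-combine M (B ∘ suc) vs-null i x }
  right-null-family (suc k) {l} {suc r} {t} B us ind null (s≤s le) | yes (j₀ , u₀≢0) =
    let M , M-ind , M-null = kernel-of-functional r (λ j → us j zero)
        us′ = combine M us
        us′-ind = combine-indep {M = M} {us} M-ind ind
        vs , vs-ind , vs-null = right-null-family k (B ∘ suc) (λ j → us′ j ∘ suc)
          (λ c rel → us′-ind c λ { zero → sumF-zero (λ j → trans (*-congˡ (M-null j)) (zeroʳ _)) ; (suc x) → rel x })
          (λ j c → trans (sym (trans (+-congʳ (trans (*-congʳ (M-null j)) (zeroˡ _))) (+-identityˡ _)))
             (LeftNull-combine M {us} B null j c))
          le
    in vs , vs-ind , λ j → λ
      { zero → x*y≡0⇒y≡0 u₀≢0 (begin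
          us j₀ zero * sumF (λ c → B zero c * vs j c)      ≡⟨ +-identityʳ _ ⟨
          us j₀ zero * sumF (λ c → B zero c * vs j c) + 0#
            ≡⟨ +-congˡ (sumF-zero λ i → trans (*-congˡ (vs-null j i)) (zeroʳ (us j₀ (suc i)))) ⟨
          sumF (λ i → us j₀ i * sumF (λ c → B i c * vs j c)) ≡⟨ sumF-assoc (us j₀) B (vs j) ⟨
          sumF (λ c → sumF (λ i → us j₀ i * B i c) * vs j c) ≡⟨ sumF-zero (λ c → trans (*-congʳ (null j₀ c)) (zeroˡ _)) ⟩
          0#                                               ∎)
      ; (suc x) → vs-null j x }
    where open ≡-Reasoning

  indep⇒≤span : ∀ {d m r} {ws : Fin m → Vec' d} (fs : Fin r → Vec' d) (M : Fin m → Fin r → F) →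
    LinIndep ws → (∀ j x → ws j x ≡ combine M fs j x) → m ≤ r
  indep⇒≤span {m = m} {r} {ws} fs M ind ws≡ = ℕₚ.≮⇒≥ λ r<m →
    -- With no left null vectors given, fewer rows than columns already yield one nonzero solution;
    -- it is a relation among the `ws`.
    let vs , vs-ind , vs-null = right-null-family r {t = 1} (λ i j → M j i) (λ ()) (λ _ _ ()) (λ ())
          (subst (_≤ m) (ℕₚ.+-comm 1 r) r<m)
        v≡0 = ind (vs zero) λ x → begin
          sumF (λ j → vs zero j * ws j x)             ≡⟨ sumF-cong (λ j → cong (vs zero j *_) (ws≡ j x)) ⟩
          sumF (λ j → vs zero j * combine M fs j x)   ≡⟨ sumF-assoc (vs zero) M (λ i → fs i x) ⟨
          sumF (λ i → sumF (λ j → vs zero j * M j i) * fs i x)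
            ≡⟨ sumF-zero (λ i → trans (*-congʳ (trans (dot-comm (vs zero) (λ j → M j i)) (vs-null zero i))) (zeroˡ _)) ⟩
          0#                                          ∎
    in 1≢0 (vs-ind (λ _ → 1#) (λ x → trans (+-identityʳ _) (trans (*-congˡ (v≡0 x)) (zeroʳ _))) zero)
    where open ≡-Reasoning

  InLeftEig : ∀ {d} → Mat d → F → Vec' d → Set
  InLeftEig A λ' u = ∀ j → sumF (λ k → u k * A k j) ≡ λ' * u j

  private
    shifted : ∀ {d} → Mat d → F → Mat d
    shifted A λ' i j = A i j + - (λ' * idMat i j)

    right-shifted : ∀ {d} (A : Mat d) λ' v i →
      sumF (λ k → shifted A λ' i k * v k) ≡ sumF (λ k → A i k * v k) + - (λ' * v i)
    right-shifted A λ' v i = begin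
      sumF (λ k → (A i k + - (λ' * idMat i k)) * v k)
        ≡⟨ sumF-cong (λ k → solve 4 (λ a l e x → (a :- l :* e) :* x := a :* x :+ :- l :* (e :* x)) refl (A i k) λ' (idMat i k) (v k)) ⟩
      sumF (λ k → A i k * v k + - λ' * (idMat i k * v k))
        ≡⟨ sumF-+ (λ k → A i k * v k) (λ k → - λ' * (idMat i k * v k)) ⟩
      sumF (λ k → A i k * v k) + sumF (λ k → - λ' * (idMat i k * v k))
        ≡⟨ +-congˡ (trans (sumF-*ˡ (- λ') (λ k → idMat i k * v k)) (*-congˡ (sumF-idMat* v i))) ⟩
      sumF (λ k → A i k * v k) + - λ' * v i
        ≡⟨ +-congˡ (sym (-‿distribˡ-* λ' (v i))) ⟩
      sumF (λ k → A i k * v k) + - (λ' * v i)  ∎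
      where open ≡-Reasoning

    left-shifted : ∀ {d} (A : Mat d) λ' u j →
      sumF (λ k → u k * shifted A λ' k j) ≡ sumF (λ k → u k * A k j) + - (λ' * u j)
    left-shifted A λ' u j = begin
      sumF (λ k → u k * shifted A λ' k j)
        ≡⟨ sumF-cong (λ k → trans (*-comm (u k) _) (*-congʳ (cong (λ e → A k j + - (λ' * e)) (idMat-sym k j)))) ⟩
      sumF (λ k → shifted (λ i j → A j i) λ' j k * u k)
        ≡⟨ right-shifted (λ i j → A j i) λ' u j ⟩
      sumF (λ k → A k j * u k) + - (λ' * u j)
        ≡⟨ +-congʳ (dot-comm (λ k → A k j) u) ⟩
      sumF (λ k → u k * A k j) + - (λ' * u j)  ∎
      where open ≡-Reasoning

  -- Since A - λ' is square, the bound k + t ≤ r + l of `right-null-family` reduces to t ≤ r. The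
  -- free t allows exactly as many eigenvectors to be requested as `EigDim` refutes.
  left⇒right-eigenvectors : ∀ {d r t} {A : Mat d} {λ'} {us : Fin r → Vec' d} →
    LinIndep us → (∀ j → InLeftEig A λ' (us j)) → t ≤ r →
    Σ (Fin t → Vec' d) λ vs → LinIndep vs × (∀ j → InEig A λ' (vs j))
  left⇒right-eigenvectors {d} {r} {t} {A} {λ'} {us} ind eig t≤r =
    let vs , vs-ind , vs-null = right-null-family d (shifted A λ') us ind
          (λ j c → trans (left-shifted A λ' (us j) c) (x≡y⇒x-y≡0 (eig j c)))
          (subst (_≤ r ℕ.+ d) (ℕₚ.+-comm t d) (ℕₚ.+-monoˡ-≤ d t≤r))
    in vs , vs-ind , λ j i → x-y≡0⇒x≡y (trans (sym (right-shifted A λ' (vs j) i)) (vs-null j i))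

  right⇒left-eigenvectors : ∀ {d r} {A : Mat d} {λ'} {vs : Fin r → Vec' d} →
    LinIndep vs → (∀ j → InEig A λ' (vs j)) →
    Σ (Fin r → Vec' d) λ us → LinIndep us × (∀ j → InLeftEig A λ' (us j))
  right⇒left-eigenvectors {A = A} {vs = vs} ind eig =
    let us , us-ind , us-eig = left⇒right-eigenvectors {A = λ i j → A j i} ind
          (λ j i → trans (dot-comm (vs j) (A i)) (eig j i)) ℕₚ.≤-refl
    in us , us-ind , λ j i → trans (dot-comm (us j) (λ k → A k i)) (us-eig j i)

  -- Galois descent

  -- Indexed by ℕ and summed from the top: dropping the last term is definitional, and the cyclic
  -- shift of a trace is composition with `suc`.
  sum< : ℕ → (ℕ → F) → F
  sum< zero f = 0#
  sum< (suc k) f = sum< k f + f k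

  sum<-cong : ∀ {f g : ℕ → F} k → (∀ i → f i ≡ g i) → sum< k f ≡ sum< k g
  sum<-cong zero h = refl
  sum<-cong (suc k) h = cong₂ _+_ (sum<-cong k h) (h k)

  sum<-shift : ∀ (f : ℕ → F) k → f 0 + sum< k (f ∘ suc) ≡ sum< (suc k) f
  sum<-shift f zero = +-comm _ _
  sum<-shift f (suc k) = trans (sym (+-assoc _ _ _)) (+-congʳ (sum<-shift f k))

  sum<-rotate : ∀ (f : ℕ → F) n → f n ≡ f 0 → sum< n (f ∘ suc) ≡ sum< n f
  sum<-rotate f n fn≡f0 = +-cancelʳ (f 0) (trans (+-comm _ _) (trans (sum<-shift f n) (+-congˡ fn≡f0)))

  sum<-linear : ∀ (a b : ℕ → F) β k → sum< k a + - (β * sum< k b) ≡ sum< k (λ i → a i + - (β * b i))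
  sum<-linear a b β zero = solve 1 (λ β → con (0 , 0) :- β :* con (0 , 0) := con (0 , 0)) refl β
  sum<-linear a b β (suc k) = trans
    (solve 5 (λ x y β u v → (x :+ u) :- β :* (y :+ v) := (x :- β :* y) :+ (u :- β :* v)) refl _ _ β _ _)
    (+-congʳ (sum<-linear a b β k))

  module _ {I : Set} where

    -- W is a predicate on functions, so it must be closed under pointwise equality explicitly. The
    -- index set I is a point for Hilbert 90 and `Fin (suc d)` for eigenvectors.
    record IsSubspace (W : (I → F) → Set) : Set where
      field
        resp  : ∀ {v w} → (∀ x → v x ≡ w x) → W v → W w
        add   : ∀ {v w} → W v → W w → W (λ x → v x + w x)
        scale : ∀ c {v} → W v → W (λ x → c * v x)

    record IsSemilinear (θ : F → F) (S : (I → F) → I → F) : Set where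
      field
        S-cong  : ∀ {v w} → (∀ x → v x ≡ w x) → ∀ x → S v x ≡ S w x
        S-add   : ∀ v w x → S (λ y → v y + w y) x ≡ S v x + S w x
        S-scale : ∀ c v x → S (λ y → c * v y) x ≡ θ c * S v x

    iterV : ((I → F) → I → F) → ℕ → (I → F) → I → F
    iterV S zero v = v
    iterV S (suc k) v = S (iterV S k v)

    module _ {θ : F → F} {n : ℕ} (θ-* : ∀ x y → θ (x * y) ≡ θ x * θ y)
      (θ-moves : ∀ k → 0 ℕ.< k → k ℕ.< n → ∃ λ b → iter θ k b ≢ b)
      {W : (I → F) → Set} (W-sub : IsSubspace W) where
      open IsSubspace W-sub

      private
        θ^-* : ∀ k x y → iter θ k (x * y) ≡ iter θ k x * iter θ k y
        θ^-* zero x y = refl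
        θ^-* (suc k) x y = trans (cong θ (θ^-* k x y)) (θ-* _ _)

      -- Dedekind's independence argument: subtracting θᵏ(b) times the relation at c
      -- from the relation at b c removes the last term.
      dedekind : ∀ k → k ℕ.< n → (w : ℕ → I → F) →
        (∀ c → W (λ x → sum< (suc k) (λ i → iter θ i c * w i x))) → W (w 0)
      dedekind zero _ w h = resp (λ x → trans (+-identityˡ _) (*-identityˡ _)) (h 1#)
      dedekind (suc k) k<n w h with θ-moves (suc k) (s≤s z≤n) k<n
      ... | b , moved = resp undo (scale (δ 0 ⁻¹)
          (dedekind k (ℕₚ.<-trans (ℕₚ.n<1+n k) k<n) (λ i x → δ i * w i x)
            λ c → resp (eliminate c) (add (h (b * c)) (scale (- β) (h c)))))
        where
        β : F
        β = iter θ (suc k) b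
        δ : ℕ → F
        -- Vanishes at i = k + 1, which removes the last term, and is nonzero at i = 0 by the choice
        -- of b, so `w 0` can be recovered.
        δ i = iter θ i b + - β
        δ0≢0 : δ 0 ≢ 0#
        δ0≢0 eq = moved (sym (x-y≡0⇒x≡y eq))
        undo : ∀ x → δ 0 ⁻¹ * (δ 0 * w 0 x) ≡ w 0 x
        undo x = trans (sym (*-assoc _ _ _)) (trans (*-congʳ (inverseˡ δ0≢0)) (*-identityˡ _))
        eliminate : ∀ c x →
          sum< (suc (suc k)) (λ i → iter θ i (b * c) * w i x) + - β * sum< (suc (suc k)) (λ i → iter θ i c * w i x)
            ≡ sum< (suc k) (λ i → iter θ i c * (δ i * w i x))
        eliminate c x = begin
          A (suc (suc k)) + - β * B (suc (suc k))
            ≡⟨ +-congˡ (sym (-‿distribˡ-* β _)) ⟩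
          A (suc (suc k)) + - (β * B (suc (suc k)))
            ≡⟨ sum<-linear _ _ β (suc (suc k)) ⟩
          sum< (suc (suc k)) (λ i → a i + - (β * (iter θ i c * w i x)))
            ≡⟨ sum<-cong (suc (suc k)) (λ i → trans
                 (cong (λ z → z * w i x + - (β * (iter θ i c * w i x))) (θ^-* i b c))
                 (solve 4 (λ p q β w → p :* q :* w :- β :* (q :* w) := q :* ((p :- β) :* w)) refl _ _ β _)) ⟩
          sum< (suc k) (λ i → iter θ i c * (δ i * w i x)) + iter θ (suc k) c * (δ (suc k) * w (suc k) x)
            ≡⟨ trans (+-congˡ (trans (*-congˡ (trans (*-congʳ (-‿inverseʳ β)) (zeroˡ _))) (zeroʳ _))) (+-identityʳ _) ⟩
          sum< (suc k) (λ i → iter θ i c * (δ i * w i x))  ∎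
          where
          open ≡-Reasoning
          a : ℕ → F
          a i = iter θ i (b * c) * w i x
          A B : ℕ → F
          A m = sum< m a
          B m = sum< m (λ i → iter θ i c * w i x)

      module _ (1≤n : 1 ≤ n) (θ^n : ∀ x → iter θ n x ≡ x)
        {S : (I → F) → I → F} (S-semi : IsSemilinear θ S) where
        open IsSemilinear S-semi

        private
          S-0 : ∀ x → S (λ _ → 0#) x ≡ 0#
          S-0 x = +-cancelʳ (S (λ _ → 0#) x) (trans (sym (S-add _ _ x))
            (trans (S-cong (λ _ → +-identityˡ 0#) x) (sym (+-identityˡ _))))

          S-sum< : ∀ (f : ℕ → I → F) k x → S (λ y → sum< k (λ i → f i y)) x ≡ sum< k (λ i → S (f i) x)
          S-sum< f zero x = S-0 x
          S-sum< f (suc k) x = trans (S-add _ _ x) (+-congʳ (S-sum< f k x))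

        -- The traces Σ Sⁱ(c v) are fixed by S, and by Dedekind they generate v.
        descent : (∀ t → (∀ x → S t x ≡ t x) → W t) → ∀ v → (∀ x → iterV S n v x ≡ v x) → W v
        descent fixed∈W v Sⁿv≡v = go n refl 1≤n
          where
          term : F → ℕ → I → F
          term c i x = iter θ i c * iterV S i v x
          trace : F → I → F
          trace c x = sum< n (λ i → term c i x)
          trace-fixed : ∀ c x → S (trace c) x ≡ trace c x
          trace-fixed c x = begin
            S (trace c) x                       ≡⟨ S-sum< (term c) n x ⟩
            sum< n (λ i → S (term c i) x)       ≡⟨ sum<-cong n (λ i → S-scale _ _ x) ⟩
            sum< n (λ i → term c (suc i) x)     ≡⟨ sum<-rotate (λ i → term c i x) n (cong₂ _*_ (θ^n c) (Sⁿv≡v x)) ⟩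
            trace c x                           ∎
            where open ≡-Reasoning
          go : ∀ m → n ≡ m → 1 ≤ m → W v
          go (suc k) refl _ = dedekind k ℕₚ.≤-refl (λ i → iterV S i v)
            λ c → fixed∈W (trace c) (trace-fixed c)

  -- Arithmetic of σ and of the twisted powers

  module Twisted (q n : ℕ) (1<q : 1 ℕ.< q) (1≤n : 1 ≤ n) (card≡ : card ≡ q ℕ.^ n) {σ : F → F}
    (generator : Subfield.GaloisGenerator q n 1<q 1≤n card≡ σ) where
    open Subfield q n 1<q 1≤n card≡ public
    open GaloisGenerator generator public

    σ-0 : σ 0# ≡ 0#
    σ-0 = +-cancelʳ (σ 0#) (trans (sym (σ-+ 0# 0#)) (trans (cong σ (+-identityˡ 0#)) (sym (+-identityˡ _))))

    σ-neg : ∀ x → σ (- x) ≡ - σ x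
    σ-neg x = +-cancelʳ (σ x) (trans (sym (σ-+ (- x) x)) (trans (cong σ (-‿inverseˡ x)) (trans σ-0 (sym (-‿inverseˡ _)))))

    σ^-+ : ∀ m x y → iter σ m (x + y) ≡ iter σ m x + iter σ m y
    σ^-+ zero x y = refl
    σ^-+ (suc m) x y = trans (cong σ (σ^-+ m x y)) (σ-+ _ _)

    σ^-* : ∀ m x y → iter σ m (x * y) ≡ iter σ m x * iter σ m y
    σ^-* zero x y = refl
    σ^-* (suc m) x y = trans (cong σ (σ^-* m x y)) (σ-* _ _)

    σ^-0 : ∀ m → iter σ m 0# ≡ 0#
    σ^-0 m = iter-fixed σ-0 m

    σ^-sumF : ∀ m {k} (f : Fin k → F) → iter σ m (sumF f) ≡ sumF (λ i → iter σ m (f i))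
    σ^-sumF m {zero} f = σ^-0 m
    σ^-sumF m {suc k} f = trans (σ^-+ m _ _) (+-congˡ (σ^-sumF m (f ∘ suc)))

    σ-prodF : ∀ {k} (f : Fin k → F) → σ (prodF f) ≡ prodF (σ ∘ f)
    σ-prodF {zero} f = σ-1
    σ-prodF {suc k} f = trans (σ-* _ _) (*-congˡ (σ-prodF (f ∘ suc)))

    -- The inverse of σ, written as a power of σ so that it inherits additivity and
    -- multiplicativity.
    τ : F → F
    τ = iter σ (ℕ.pred n)

    στ : ∀ x → σ (τ x) ≡ x
    στ x = trans (cong (λ m → iter σ m x) (ℕₚ.suc-pred n)) (σ^n x)

    τσ : ∀ x → τ (σ x) ≡ x
    τσ x = trans (sym (iter-suc σ (ℕ.pred n) x)) (στ x)

    σ^τ^ : ∀ k x → iter σ k (iter τ k x) ≡ x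
    σ^τ^ zero x = refl
    σ^τ^ (suc k) x = trans (iter-suc σ k _) (trans (cong (iter σ k) (στ _)) (σ^τ^ k x))

    τ-* : ∀ x y → τ (x * y) ≡ τ x * τ y
    τ-* = σ^-* (ℕ.pred n)

    τ^n : ∀ x → iter τ n x ≡ x
    τ^n x = trans (sym (σ^n _)) (σ^τ^ n x)

    τ-moves : ∀ k → 0 ℕ.< k → k ℕ.< n → ∃ λ b → iter τ k b ≢ b
    τ-moves k 0<k k<n with σ-moves k 0<k k<n
    ... | b , moved = b , λ eq → moved (trans (cong (iter σ k) (sym eq)) (σ^τ^ k b))

    σ-injective : ∀ {x y} → σ x ≡ σ y → x ≡ y
    σ-injective eq = trans (sym (τσ _)) (trans (cong τ eq) (τσ _))

    σ-≢0 : ∀ {x} → x ≢ 0# → σ x ≢ 0#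
    σ-≢0 x≢0 eq = x≢0 (σ-injective (trans eq (sym σ-0)))

    infix 30 _⟦_⟧
    _⟦_⟧ : F → ℕ → F
    y ⟦ i ⟧ = bracketPow σ y i

    ⟦⟧-suc : ∀ y i → y ⟦ suc i ⟧ ≡ y * σ (y ⟦ i ⟧)
    ⟦⟧-suc y i = *-congˡ (sym (σ-prodF {i} (λ j → iter σ (toℕ j) y)))

    ⟦⟧-snoc : ∀ y i → y ⟦ suc i ⟧ ≡ y ⟦ i ⟧ * iter σ i y
    ⟦⟧-snoc y i = trans (prodF-last {i} (λ j → iter σ (toℕ j) y)) (cong₂ _*_
      (prodF-cong {i} λ j → cong (λ k → iter σ k y) (toℕ-inject₁ j))
      (cong (λ k → iter σ k y) (toℕ-fromℕ i)))

    ⟦⟧-* : ∀ x y i → (x * y) ⟦ i ⟧ ≡ x ⟦ i ⟧ * y ⟦ i ⟧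
    ⟦⟧-* x y zero = sym (*-identityˡ 1#)
    ⟦⟧-* x y (suc i) = begin
      (x * y) ⟦ suc i ⟧                                    ≡⟨ ⟦⟧-snoc (x * y) i ⟩
      (x * y) ⟦ i ⟧ * iter σ i (x * y)                     ≡⟨ cong₂ _*_ (⟦⟧-* x y i) (σ^-* i x y) ⟩
      x ⟦ i ⟧ * y ⟦ i ⟧ * (iter σ i x * iter σ i y)
        ≡⟨ solve 4 (λ a b c d → a :* b :* (c :* d) := a :* c :* (b :* d)) refl (x ⟦ i ⟧) (y ⟦ i ⟧) _ _ ⟩
      x ⟦ i ⟧ * iter σ i x * (y ⟦ i ⟧ * iter σ i y)        ≡⟨ cong₂ _*_ (⟦⟧-snoc x i) (⟦⟧-snoc y i) ⟨
      x ⟦ suc i ⟧ * y ⟦ suc i ⟧                            ∎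
      where open ≡-Reasoning

    ⟦⟧-1 : ∀ i → 1# ⟦ i ⟧ ≡ 1#
    ⟦⟧-1 zero = refl
    ⟦⟧-1 (suc i) = trans (⟦⟧-suc 1# i) (trans (*-identityˡ _) (trans (cong σ (⟦⟧-1 i)) σ-1))

    ⟦⟧-≢0 : ∀ {y} → y ≢ 0# → ∀ i → y ⟦ i ⟧ ≢ 0#
    ⟦⟧-≢0 y≢0 zero = 1≢0
    ⟦⟧-≢0 {y} y≢0 (suc i) eq = *-≢0 y≢0 (σ-≢0 (⟦⟧-≢0 y≢0 i)) (trans (sym (⟦⟧-suc y i)) eq)

    N : F → F
    N y = y ⟦ n ⟧

    neg∈Fq : ∀ {x} → InFq x → InFq (- x)
    neg∈Fq x∈ = fixed⇒Fq (trans (σ-neg _) (cong -_ (Fq⇒fixed x∈)))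

    +∈Fq : ∀ {x y} → InFq x → InFq y → InFq (x + y)
    +∈Fq x∈ y∈ = fixed⇒Fq (trans (σ-+ _ _) (cong₂ _+_ (Fq⇒fixed x∈) (Fq⇒fixed y∈)))

    ⁻¹∈Fq : ∀ {x} → x ≢ 0# → InFq x → InFq (x ⁻¹)
    ⁻¹∈Fq {x} x≢0 x∈ = fixed⇒Fq (*-cancelˡ x≢0 (begin
      x * σ (x ⁻¹)       ≡⟨ *-congʳ (Fq⇒fixed x∈) ⟨
      σ x * σ (x ⁻¹)     ≡⟨ σ-* _ _ ⟨
      σ (x * x ⁻¹)       ≡⟨ cong σ (inverse x x≢0) ⟩
      σ 1#               ≡⟨ σ-1 ⟩
      1#                 ≡⟨ inverse x x≢0 ⟨
      x * x ⁻¹           ∎))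
      where open ≡-Reasoning

    -- Bases and spans over F_q inside the field

    FqIndep : ∀ {r} → (Fin r → F) → Set
    FqIndep {r} x = ∀ (c : Fin r → F) → (∀ i → InFq (c i)) → sumF (λ i → c i * x i) ≡ 0# → ∀ i → c i ≡ 0#

    FqSpan : ∀ {r} → (Fin r → F) → F → Set
    FqSpan {r} x y = Σ (Fin r → F) λ c → (∀ i → InFq (c i)) × y ≡ sumF (λ i → c i * x i)

    ∈Fq⇒InFq : ∀ {x} → x ∈ Fq → InFq x
    ∈Fq⇒InFq x∈ = proj₂ (∈-filter⁻ inFq? {xs = elements} x∈)

    InFq⇒∈Fq : ∀ {x} → InFq x → x ∈ Fq
    InFq⇒∈Fq = ∈-filter⁺ inFq? (complete _)

    Fq-unique : Unique Fq
    Fq-unique = Unique.filter⁺ inFq? unique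

    private
      value : ∀ {r} → (Fin r → F) → Vec F r → F
      value x c = sumF (λ i → lookup c i * x i)

      span⇒word : ∀ {r} {x : Fin r → F} {y} → FqSpan x y → ∃ λ c → c ∈ words Fq r × y ≡ value x c
      span⇒word {x = x} (c , c∈ , y≡) = tabulate c
        , ∈-words⁺ (tabulate c) (λ i → InFq⇒∈Fq (subst InFq (sym (lookup∘tabulate c i)) (c∈ i)))
        , trans y≡ (sumF-cong λ i → cong (_* x i) (sym (lookup∘tabulate c i)))

      word⇒span : ∀ {r} {x : Fin r → F} {c} → c ∈ words Fq r → FqSpan x (value x c)
      word⇒span {c = c} c∈ = lookup c , (λ i → ∈Fq⇒InFq (∈-words⁻ c∈ i)) , refl

    fqSpan? : ∀ {r} (x : Fin r → F) y → Dec (FqSpan x y)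
    fqSpan? {r} x y = map′
      (λ any → let c , c∈ , y≡ = find any in subst (FqSpan x) (sym y≡) (word⇒span {x = x} c∈))
      (λ span → let c , c∈ , y≡ = span⇒word {x = x} span in lose c∈ y≡)
      (Any.any? (λ c → y ≟F value x c) (words Fq r))

    -- Independence makes coefficients unique, so the span is in bijection with the q^r words over
    -- F_q.
    #span : ∀ {r} {x : Fin r → F} {zs} → FqIndep x → Unique zs →
      (∀ {y} → y ∈ zs → FqSpan x y) → (∀ {y} → FqSpan x y → y ∈ zs) → length zs ≡ q ℕ.^ r
    #span {r} {x} {zs} ind zs-unique to from = begin
      length zs                              ≡⟨ ↭-length (unique-↭ zs-unique (unique-map value-injective (words-unique Fq-unique r)) zs⊆ zs⊇) ⟩
      length (map (value x) (words Fq r))    ≡⟨ length-map (value x) (words Fq r) ⟩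
      length (words Fq r)                    ≡⟨ length-words Fq r ⟩
      length Fq ℕ.^ r                        ≡⟨ cong (ℕ._^ r) #Fq≡q ⟩
      q ℕ.^ r                                ∎
      where
      open ≡-Reasoning
      value-injective : ∀ {c c′} → c ∈ words Fq r → c′ ∈ words Fq r → value x c ≡ value x c′ → c ≡ c′
      value-injective {c} {c′} c∈ c′∈ eq = lookup-injective λ i → x-y≡0⇒x≡y
        (ind (λ i → lookup c i + - lookup c′ i)
          (λ i → +∈Fq (∈Fq⇒InFq (∈-words⁻ c∈ i)) (neg∈Fq (∈Fq⇒InFq (∈-words⁻ c′∈ i))))
          (trans (sumF-cong {r} λ i → solve 3 (λ a b x → (a :- b) :* x := a :* x :+ :- (b :* x)) refl (lookup c i) (lookup c′ i) (x i))
            (trans (sumF-+ (λ i → lookup c i * x i) _)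
              (trans (+-congˡ (sumF-neg (λ i → lookup c′ i * x i))) (x≡y⇒x-y≡0 eq))))
          i)
      zs⊆ : ∀ {y} → y ∈ zs → y ∈ map (value x) (words Fq r)
      zs⊆ y∈ with span⇒word {x = x} (to y∈)
      ... | c , c∈ , y≡ = subst (_∈ map (value x) (words Fq r)) (sym y≡) (∈-map⁺ (value x) c∈)
      zs⊇ : ∀ {y} → y ∈ map (value x) (words Fq r) → y ∈ zs
      zs⊇ y∈ with ∈-map⁻ (value x) y∈
      ... | c , c∈ , refl = from (word⇒span {x = x} c∈)

    private
      snoc : ∀ {r} → F → (Fin r → F) → Fin (suc r) → F
      snoc y x zero = y
      snoc y x (suc i) = x i

      span-snoc : ∀ {r} {x : Fin r → F} z {y} → FqSpan x y → FqSpan (snoc z x) y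
      span-snoc z (c , c∈ , y≡) = snoc 0# c , (λ { zero → 0∈Fq ; (suc i) → c∈ i })
        , trans y≡ (sym (trans (+-congʳ (zeroˡ z)) (+-identityˡ _)))

      -- A relation in which y has a nonzero coefficient can be solved for y, and the solution has
      -- coefficients in F_q because F_q is closed under inverses.
      indep-snoc : ∀ {r} {x : Fin r → F} {y} → FqIndep x → (FqSpan x y → ∀ {A : Set} → A) → FqIndep (snoc y x)
      indep-snoc {r} {x} {y} ind y∉ c c∈ rel with c zero ≟F 0#
      ... | yes c₀≡0 = λ { zero → c₀≡0 ; (suc i) → ind (c ∘ suc) (c∈ ∘ suc)
              (trans (sym (trans (+-congʳ (trans (*-congʳ c₀≡0) (zeroˡ y))) (+-identityˡ _))) rel) i }
      ... | no c₀≢0 = y∉ (e , (λ i → *∈Fq (neg∈Fq (⁻¹∈Fq c₀≢0 (c∈ zero))) (c∈ (suc i))) , (begin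
          y                              ≡⟨ *-identityˡ y ⟨
          1# * y                         ≡⟨ *-congʳ (inverseˡ c₀≢0) ⟨
          b * c zero * y                 ≡⟨ solve 4 (λ b c y s → b :* c :* y := b :* (c :* y :+ s) :+ :- b :* s) refl b (c zero) y s ⟩
          b * (c zero * y + s) + - b * s ≡⟨ +-congʳ (trans (*-congˡ rel) (zeroʳ b)) ⟩
          0# + - b * s                   ≡⟨ +-identityˡ _ ⟩
          - b * s                        ≡⟨ sumF-*ˡ (- b) (λ i → c (suc i) * x i) ⟨
          sumF (λ i → - b * (c (suc i) * x i))  ≡⟨ sumF-cong {r} (λ i → sym (*-assoc (- b) (c (suc i)) (x i))) ⟩
          sumF (λ i → e i * x i)         ∎))
        where
        open ≡-Reasoning
        b s : F
        b = c zero ⁻¹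
        s = sumF (λ i → c (suc i) * x i)
        e : Fin r → F
        e i = - b * c (suc i)

    -- Greedy choice: an element is kept exactly when it is outside the span of those kept before,
    -- which can be decided by trying all coefficient words.
    basis : ∀ ys → ∃ λ r → Σ (Fin r → F) λ x → (∀ i → x i ∈ ys) × FqIndep x × (∀ {y} → y ∈ ys → FqSpan x y)
    basis [] = 0 , (λ ()) , (λ ()) , (λ _ _ _ ()) , λ ()
    basis (y ∷ ys) with basis ys
    ... | r , x , x∈ , ind , span with fqSpan? x y
    ...   | yes y∈span = r , x , there ∘ x∈ , ind , λ { (here refl) → y∈span ; (there z∈) → span z∈ }
    ...   | no y∉span = suc r , snoc y x , (λ { zero → here refl ; (suc i) → there (x∈ i) })
        , indep-snoc ind (λ y∈span → ⊥-elim (y∉span y∈span))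
        , λ { (here refl) → snoc 1# (λ _ → 0#) , (λ { zero → 1∈Fq ; (suc i) → 0∈Fq })
                , sym (trans (+-congˡ (sumF-zero {r} λ i → zeroˡ (x i))) (trans (+-identityʳ _) (*-identityˡ y)))
            ; (there z∈) → span-snoc y (span z∈) }

    -- Hilbert 90 and the fibres of the norm

    -- The map v ↦ c σ(v) is semilinear and its n-th power sends 1 to N(c) = 1. If 0 were its only
    -- fixed point, descent into the zero subspace would give 1 = 0. A search through the units
    -- makes the witness explicit.
    hilbert90 : ∀ {c} → N c ≡ 1# → ∃ λ x → x ≢ 0# × c * σ x ≡ x
    hilbert90 {c} Nc≡1 with Any.any? (λ x → (c * σ x) ≟F x) units
    ... | yes any = let x , x∈ , eq = find any in x , ∈units⇒≢0 x∈ , eq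
    ... | no none = ⊥-elim (1≢0 (descent {I = ⊤} {n = n} σ-* σ-moves zero-subspace 1≤n σ^n semilinear only-zero
                      (λ _ → 1#) (λ _ → trans (S^k1 n) Nc≡1)))
      where
      S : (⊤ → F) → ⊤ → F
      S v _ = c * σ (v tt)
      zero-subspace : IsSubspace (λ v → v tt ≡ 0#)
      zero-subspace = record
        { resp = λ v≡w v≡0 → trans (sym (v≡w tt)) v≡0
        ; add = λ v≡0 w≡0 → trans (cong₂ _+_ v≡0 w≡0) (+-identityˡ 0#)
        ; scale = λ b v≡0 → trans (*-congˡ v≡0) (zeroʳ b)
        }
      semilinear : IsSemilinear σ S
      semilinear = record
        { S-cong = λ v≡w _ → cong (λ z → c * σ z) (v≡w tt)
        ; S-add = λ v w _ → trans (*-congˡ (σ-+ _ _)) (distribˡ _ _ _)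
        ; S-scale = λ b v _ → trans (*-congˡ (σ-* b (v tt))) (solve 3 (λ c b v → c :* (b :* v) := b :* (c :* v)) refl c (σ b) (σ (v tt)))
        }
      S^k1 : ∀ k → iterV S k (λ _ → 1#) tt ≡ c ⟦ k ⟧
      S^k1 zero = refl
      S^k1 (suc k) = trans (cong (λ z → c * σ z) (S^k1 k)) (sym (⟦⟧-suc c k))
      only-zero : ∀ t → (∀ x → S t x ≡ t x) → t tt ≡ 0#
      only-zero t St≡t with t tt ≟F 0#
      ... | yes t≡0 = t≡0
      ... | no t≢0 = ⊥-elim (none (lose (≢0⇒∈units t≢0) (St≡t tt)))

    -- Peeling a factor off either end of y^[n+1] gives y σ(N y) = N(y) σⁿ(y) = N(y) y.
    N∈Fq : ∀ {y} → y ≢ 0# → InFq (N y)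
    N∈Fq {y} y≢0 = fixed⇒Fq (*-cancelˡ y≢0 (begin
      y * σ (N y)          ≡⟨ ⟦⟧-suc y n ⟨
      y ⟦ suc n ⟧          ≡⟨ ⟦⟧-snoc y n ⟩
      N y * iter σ n y     ≡⟨ *-congˡ (σ^n y) ⟩
      N y * y              ≡⟨ *-comm _ _ ⟩
      y * N y              ∎))
      where open ≡-Reasoning

    -- For y = μ σ(x)/x the quotients σ^(j+1)(x)/σ^j(x) telescope in y^[i]; multiplying through by x
    -- keeps the statement free of division. It drives both the norm comparison and the passage from
    -- P_L to L_μ.
    twisted-⟦⟧ : ∀ {y μ x} → y * x ≡ μ * σ x → ∀ i → y ⟦ i ⟧ * x ≡ μ ⟦ i ⟧ * iter σ i x
    twisted-⟦⟧ eq zero = refl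
    twisted-⟦⟧ {y} {μ} {x} eq (suc i) = begin
      y ⟦ suc i ⟧ * x                  ≡⟨ *-congʳ (⟦⟧-suc y i) ⟩
      y * σ (y ⟦ i ⟧) * x              ≡⟨ solve 3 (λ y s x → y :* s :* x := y :* x :* s) refl y _ x ⟩
      y * x * σ (y ⟦ i ⟧)              ≡⟨ *-congʳ eq ⟩
      μ * σ x * σ (y ⟦ i ⟧)            ≡⟨ solve 3 (λ m s t → m :* s :* t := m :* (t :* s)) refl μ _ _ ⟩
      μ * (σ (y ⟦ i ⟧) * σ x)          ≡⟨ *-congˡ (trans (sym (σ-* _ _)) (trans (cong σ (twisted-⟦⟧ eq i)) (σ-* _ _))) ⟩
      μ * (σ (μ ⟦ i ⟧) * iter σ (suc i) x) ≡⟨ trans (sym (*-assoc _ _ _)) (*-congʳ (sym (⟦⟧-suc μ i))) ⟩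
      μ ⟦ suc i ⟧ * iter σ (suc i) x   ∎
      where open ≡-Reasoning

    twisted-N : ∀ {y μ x} → x ≢ 0# → y * x ≡ μ * σ x → N y ≡ N μ
    twisted-N {y} {μ} {x} x≢0 eq = *-cancelˡ x≢0 (trans (*-comm _ _)
      (trans (twisted-⟦⟧ eq n) (trans (*-congˡ (σ^n x)) (*-comm _ _))))

    ∑-rescale : ∀ (f : F → ℕ) {c} → c ≢ 0# → ∑ f elements ≡ ∑ (λ x → f (x * c)) elements
    ∑-rescale f {c} c≢0 = trans
      (sym (∑-↭ f (elements-↭ (_* c) (_* c ⁻¹) (λ x → undo x (inverseˡ c≢0)) λ x → undo x (inverse c c≢0))))
      (cong sum (sym (map-∘ elements)))
      where
      undo : ∀ x {a b} → a * b ≡ 1# → x * a * b ≡ x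
      undo x ab≡1 = trans (*-assoc _ _ _) (trans (*-congˡ ab≡1) (*-identityʳ x))

    nz : F → ℕ
    nz x = 𝟙 (nonzero? x)

    nz-cong : ∀ x {l m} → (x ≢ 0# → l ≡ m) → nz x ℕ.* l ≡ nz x ℕ.* m
    nz-cong x = 𝟙-*-cong (nonzero? x)

    -- `κ` is the order of the multiplicative group, kept as the sum of indicators in which the
    -- double counts end; `k` is q - 1, the order of F_q^×.
    κ k : ℕ
    κ = ∑ nz elements
    k = ℕ.pred q

    κ≢0 : κ ≢ 0
    κ≢0 κ≡0 with units | ≢0⇒∈units 1≢0 | length-filter≡∑ nonzero? elements
    ... | [] | () | _
    ... | _ ∷ _ | _ | eq with () ← trans eq κ≡0

    Fq* : List F
    Fq* = filter nonzero? Fq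

    ∑Fq-nz : ∑ nz Fq ≡ k
    ∑Fq-nz = trans (sym (length-filter≡∑ nonzero? Fq))
      (ℕₚ.suc-injective (trans (sym (length≡1+nonzero Fq-unique (InFq⇒∈Fq 0∈Fq))) (trans #Fq≡q (sym (ℕₚ.suc-pred q)))))

    -- Equal norms let Hilbert 90 provide one nonzero solution x₀ of μ x = μ₀ σ(x). Putting x = z x₀
    -- reduces the equation to σ(z) = z, so the nonzero solutions are the F_q^×-multiples of x₀.
    #twisted-fixed : ∀ {μ μ₀} → μ ≢ 0# → μ₀ ≢ 0# → N μ ≡ N μ₀ → ∑ (λ x → nz x ℕ.* 𝟙 ((μ * x) ≟F (μ₀ * σ x))) elements ≡ k
    #twisted-fixed {μ} {μ₀} μ≢0 μ₀≢0 Nμ≡Nμ₀ with hilbert90 {μ ⁻¹ * μ₀} N≡1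
      where
      N≡1 : N (μ ⁻¹ * μ₀) ≡ 1#
      N≡1 = begin
        N (μ ⁻¹ * μ₀)          ≡⟨ ⟦⟧-* (μ ⁻¹) μ₀ n ⟩
        N (μ ⁻¹) * N μ₀        ≡⟨ *-congˡ Nμ≡Nμ₀ ⟨
        N (μ ⁻¹) * N μ         ≡⟨ ⟦⟧-* (μ ⁻¹) μ n ⟨
        N (μ ⁻¹ * μ)           ≡⟨ trans (cong N (inverseˡ μ≢0)) (⟦⟧-1 n) ⟩
        1#                     ∎
        where open ≡-Reasoning
    ... | x₀ , x₀≢0 , eq = begin
      ∑ (λ x → nz x ℕ.* 𝟙 ((μ * x) ≟F (μ₀ * σ x))) elements
        ≡⟨ ∑-rescale _ x₀≢0 ⟩
      ∑ (λ z → nz (z * x₀) ℕ.* 𝟙 ((μ * (z * x₀)) ≟F (μ₀ * σ (z * x₀)))) elements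
        ≡⟨ ∑-cong elements (λ z → cong₂ ℕ._*_
             (𝟙-⇔ (nonzero? (z * x₀)) (nonzero? z) (λ zx≢0 z≡0 → zx≢0 (trans (*-congʳ z≡0) (zeroˡ x₀))) (λ z≢0 → *-≢0 z≢0 x₀≢0))
             (𝟙-⇔ ((μ * (z * x₀)) ≟F (μ₀ * σ (z * x₀))) (inFq? z) (to z) (from z))) ⟩
      ∑ (λ z → nz z ℕ.* 𝟙 (inFq? z)) elements
        ≡⟨ ∑-cong elements (λ z → ℕₚ.*-comm (nz z) _) ⟩
      ∑ (λ z → 𝟙 (inFq? z) ℕ.* nz z) elements
        ≡⟨ ∑-filter inFq? nz elements ⟨
      ∑ nz Fq  ≡⟨ ∑Fq-nz ⟩
      k        ∎
      where
      open ≡-Reasoning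
      p : F
      p = μ₀ * σ x₀
      p≢0 : p ≢ 0#
      p≢0 = *-≢0 μ₀≢0 (σ-≢0 x₀≢0)
      μx₀≡p : μ * x₀ ≡ p
      μx₀≡p = begin
        μ * x₀                        ≡⟨ *-congˡ eq ⟨
        μ * (μ ⁻¹ * μ₀ * σ x₀)        ≡⟨ solve 4 (λ m i n s → m :* (i :* n :* s) := m :* i :* (n :* s)) refl μ (μ ⁻¹) μ₀ (σ x₀) ⟩
        μ * μ ⁻¹ * p                  ≡⟨ *-congʳ (inverse μ μ≢0) ⟩
        1# * p                        ≡⟨ *-identityˡ p ⟩
        p                             ∎
      lhs : ∀ z → μ * (z * x₀) ≡ p * z
      lhs z = trans (solve 3 (λ m z x → m :* (z :* x) := m :* x :* z) refl μ z x₀) (*-congʳ μx₀≡p)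
      rhs : ∀ z → μ₀ * σ (z * x₀) ≡ p * σ z
      rhs z = trans (*-congˡ (σ-* z x₀)) (solve 3 (λ m z x → m :* (z :* x) := m :* x :* z) refl μ₀ (σ z) (σ x₀))
      to : ∀ z → μ * (z * x₀) ≡ μ₀ * σ (z * x₀) → InFq z
      to z e = fixed⇒Fq (sym (*-cancelˡ p≢0 (trans (sym (lhs z)) (trans e (rhs z)))))
      from : ∀ z → InFq z → μ * (z * x₀) ≡ μ₀ * σ (z * x₀)
      from z z∈ = trans (lhs z) (trans (*-congˡ (sym (Fq⇒fixed z∈))) (sym (rhs z)))

    fibre : F → ℕ
    fibre λ' = ∑ (λ μ → nz μ ℕ.* 𝟙 (λ' ≟F N μ)) elements

    private
      rearrange : ∀ a b c → a ℕ.* b ℕ.* c ≡ b ℕ.* (c ℕ.* a)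
      rearrange a b c = trans (cong (ℕ._* c) (ℕₚ.*-comm a b)) (trans (ℕₚ.*-assoc b a c) (cong (b ℕ.*_) (ℕₚ.*-comm a c)))

    -- Double counting of the pairs (μ , x) with N(μ) = N(μ₀) and μ x = μ₀ σ(x), x ≠ 0.
    fibre-N : ∀ {μ₀} → μ₀ ≢ 0# → fibre (N μ₀) ℕ.* k ≡ κ
    fibre-N {μ₀} μ₀≢0 = begin
      fibre (N μ₀) ℕ.* k
        ≡⟨ ∑-*ʳ w elements k ⟨
      ∑ (λ μ → w μ ℕ.* k) elements
        ≡⟨ ∑-cong elements (λ μ → trans (ℕₚ.*-assoc (nz μ) _ k) (trans
             (nz-cong μ λ μ≢0 → 𝟙-*-cong (N μ₀ ≟F N μ) λ Nμ₀≡Nμ → sym (#twisted-fixed μ≢0 μ₀≢0 (sym Nμ₀≡Nμ)))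
             (sym (ℕₚ.*-assoc (nz μ) _ _)))) ⟩
      ∑ (λ μ → w μ ℕ.* ∑ (λ x → nz x ℕ.* t μ x) elements) elements
        ≡⟨ ∑-cong elements (λ μ → trans (sym (∑-*ˡ (w μ) (λ x → nz x ℕ.* t μ x) elements))
             (∑-cong elements λ x → trans (sym (ℕₚ.*-assoc (w μ) (nz x) (t μ x))) (rearrange (w μ) (nz x) (t μ x)))) ⟩
      ∑ (λ μ → ∑ (λ x → nz x ℕ.* (t μ x ℕ.* w μ)) elements) elements
        ≡⟨ ∑-swap (λ μ x → nz x ℕ.* (t μ x ℕ.* w μ)) elements elements ⟩
      ∑ (λ x → ∑ (λ μ → nz x ℕ.* (t μ x ℕ.* w μ)) elements) elements
        ≡⟨ ∑-cong elements (λ x → trans (∑-*ˡ (nz x) (λ μ → t μ x ℕ.* w μ) elements) (trans (nz-cong x (λ x≢0 → unique-μ x x≢0)) (ℕₚ.*-identityʳ (nz x)))) ⟩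
      κ  ∎
      where
      open ≡-Reasoning
      w : F → ℕ
      w μ = nz μ ℕ.* 𝟙 (N μ₀ ≟F N μ)
      t : F → F → ℕ
      t μ x = 𝟙 ((μ * x) ≟F (μ₀ * σ x))
      -- A given x ≠ 0 forces μ = μ₀ σ(x)/x, which automatically has the norm of μ₀.
      unique-μ : ∀ x → x ≢ 0# → ∑ (λ μ → t μ x ℕ.* w μ) elements ≡ 1
      unique-μ x x≢0 = begin
        ∑ (λ μ → t μ x ℕ.* w μ) elements
          ≡⟨ ∑-cong elements (λ μ → cong (ℕ._* w μ) (𝟙-⇔ ((μ * x) ≟F (μ₀ * σ x)) (μ ≟F y)
               (λ e → *-cancelˡ x≢0 (trans (*-comm _ _) (trans e (trans (sym yx≡) (*-comm _ _)))))
               λ e → trans (*-congʳ e) yx≡)) ⟩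
        ∑ (λ μ → 𝟙 (μ ≟F y) ℕ.* w μ) elements
          ≡⟨ ∑-𝟙-* _≟F_ w unique (complete y) ⟩
        w y
          ≡⟨ cong₂ ℕ._*_ (𝟙-yes (nonzero? y) (*-≢0 (*-≢0 μ₀≢0 (σ-≢0 x≢0)) (⁻¹-≢0 x≢0)))
                         (𝟙-yes (N μ₀ ≟F N y) (sym (twisted-N x≢0 yx≡))) ⟩
        1  ∎
        where
        y : F
        y = μ₀ * σ x * x ⁻¹
        yx≡ : y * x ≡ μ₀ * σ x
        yx≡ = trans (*-assoc _ _ _) (trans (*-congˡ (inverseˡ x≢0)) (*-identityʳ _))

    ∑-fibre-* : ∀ (g : F → ℕ) → ∑ (λ λ' → fibre λ' ℕ.* g λ') Fq ≡ ∑ (λ μ → nz μ ℕ.* g (N μ)) elements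
    ∑-fibre-* g = begin
      ∑ (λ λ' → fibre λ' ℕ.* g λ') Fq
        ≡⟨ ∑-cong Fq (λ λ' → sym (∑-*ʳ (λ μ → nz μ ℕ.* 𝟙 (λ' ≟F N μ)) elements (g λ'))) ⟩
      ∑ (λ λ' → ∑ (λ μ → nz μ ℕ.* 𝟙 (λ' ≟F N μ) ℕ.* g λ') elements) Fq
        ≡⟨ ∑-swap (λ λ' μ → nz μ ℕ.* 𝟙 (λ' ≟F N μ) ℕ.* g λ') Fq elements ⟩
      ∑ (λ μ → ∑ (λ λ' → nz μ ℕ.* 𝟙 (λ' ≟F N μ) ℕ.* g λ') Fq) elements
        ≡⟨ ∑-cong elements (λ μ → trans
             (trans (∑-cong Fq λ λ' → ℕₚ.*-assoc (nz μ) (𝟙 (λ' ≟F N μ)) (g λ')) (∑-*ˡ (nz μ) (λ λ' → 𝟙 (λ' ≟F N μ) ℕ.* g λ') Fq))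
             (nz-cong μ λ μ≢0 → ∑-𝟙-* _≟F_ g Fq-unique (InFq⇒∈Fq (N∈Fq μ≢0)))) ⟩
      ∑ (λ μ → nz μ ℕ.* g (N μ)) elements  ∎
      where open ≡-Reasoning

    -- Each fibre of the norm over Fq* has at most κ / k elements, and on average it has that many.
    fibre-size : ∀ {λ'} → λ' ∈ Fq* → fibre λ' ℕ.* k ≡ κ
    fibre-size = ∑-saturated Fq* (λ _ → fibre≤ _) total
      where
      fibre≤ : ∀ λ' → fibre λ' ℕ.* k ≤ κ
      fibre≤ λ' with Any.any? (λ μ → λ' ≟F N μ) units
      ... | yes any = let μ , μ∈ , eq = find any in
        ℕₚ.≤-reflexive (subst (λ z → fibre z ℕ.* k ≡ κ) (sym eq) (fibre-N (∈units⇒≢0 μ∈)))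
      ... | no none = subst (λ z → z ℕ.* k ≤ κ) (sym fibre≡0) z≤n
        where
        fibre≡0 : fibre λ' ≡ 0
        fibre≡0 = trans
          (∑-cong elements λ μ → trans (nz-cong μ λ μ≢0 → 𝟙-no (λ' ≟F N μ) λ eq → none (lose (≢0⇒∈units μ≢0) eq)) (ℕₚ.*-zeroʳ (nz μ)))
          (trans (∑-const 0 elements) (ℕₚ.*-zeroʳ (length elements)))
      -- The norm maps units to F_q^×, so the fibres over `Fq*` partition the `κ` units.
      total : ∑ (λ λ' → fibre λ' ℕ.* k) Fq* ≡ length Fq* ℕ.* κ
      total = begin
        ∑ (λ λ' → fibre λ' ℕ.* k) Fq*                   ≡⟨ ∑-filter nonzero? (λ λ' → fibre λ' ℕ.* k) Fq ⟩
        ∑ (λ λ' → nz λ' ℕ.* (fibre λ' ℕ.* k)) Fq        ≡⟨ ∑-cong Fq (λ λ' → trans (sym (ℕₚ.*-assoc (nz λ') _ k)) (trans (rearrange (nz λ') (fibre λ') k) (cong (fibre λ' ℕ.*_) (ℕₚ.*-comm k _)))) ⟩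
        ∑ (λ λ' → fibre λ' ℕ.* (nz λ' ℕ.* k)) Fq        ≡⟨ ∑-fibre-* (λ λ' → nz λ' ℕ.* k) ⟩
        ∑ (λ μ → nz μ ℕ.* (nz (N μ) ℕ.* k)) elements
          ≡⟨ ∑-cong elements (λ μ → nz-cong μ λ μ≢0 → trans (cong (ℕ._* k) (𝟙-yes (nonzero? (N μ)) (⟦⟧-≢0 μ≢0 n))) (ℕₚ.*-identityˡ k)) ⟩
        ∑ (λ μ → nz μ ℕ.* k) elements                   ≡⟨ ∑-*ʳ nz elements k ⟩
        κ ℕ.* k                                         ≡⟨ ℕₚ.*-comm κ k ⟩
        k ℕ.* κ                                         ≡⟨ cong (ℕ._* κ) (trans (length-filter≡∑ nonzero? Fq) ∑Fq-nz) ⟨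
        length Fq* ℕ.* κ                                ∎
        where open ≡-Reasoning

    countRoots-∑ : ∀ f → countRoots f ≡ ∑ (λ x → 𝟙 (f x ≟F 0#)) elements
    countRoots-∑ f = length-filter≡∑ (λ x → f x ≟F 0#) elements

    -- The companion matrix and the vectors attached to roots of L_μ; the σ-degree is `suc d`

    module Companion (d : ℕ) (a : Fin (suc (suc d)) → F)
      (a₀≢0 : a zero ≢ 0#) (aₙ≢0 : a (fromℕ (suc d)) ≢ 0#) where

      C : Mat (suc d)
      C = companion d a

      A : Mat (suc d)
      A = AL σ d a n

      aₙ : F
      aₙ = a (fromℕ (suc d))

      rowC : Vec' (suc d) → Vec' (suc d)
      rowC u j = sumF (λ k → u k * C k j)

      private
        subdiagonal : Fin (suc d) → Fin (suc d) → F
        subdiagonal i j = if does (toℕ i ℕ.≟ suc (toℕ j)) then 1# else 0#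

        lastColumn : Fin (suc d) → F
        lastColumn i = - (a (inject₁ i) * aₙ ⁻¹)

        C-last : ∀ i → C i (fromℕ d) ≡ - (a (inject₁ i) * aₙ ⁻¹)
        C-last i = cong (if_then lastColumn i else subdiagonal i (fromℕ d)) (dec-true (fromℕ d ≟ fromℕ d) refl)

        C-inject₁ : ∀ i j → C i (inject₁ j) ≡ idMat i (suc j)
        C-inject₁ i j = trans
          (cong (if_then lastColumn i else subdiagonal i (inject₁ j)) (dec-false (inject₁ j ≟ fromℕ d) (fromℕ≢inject₁ ∘ sym)))
          subdiagonal≡
          where
          subdiagonal≡ : subdiagonal i (inject₁ j) ≡ idMat i (suc j)
          subdiagonal≡ with i ≟ suc j
          ... | yes refl = cong (if_then 1# else 0#)
            (dec-true (suc (toℕ j) ℕ.≟ suc (toℕ (inject₁ j))) (cong suc (sym (toℕ-inject₁ j))))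
          ... | no i≢j = cong (if_then 1# else 0#)
            (dec-false (toℕ i ℕ.≟ suc (toℕ (inject₁ j))) λ eq → i≢j (toℕ-injective (trans eq (cong suc (toℕ-inject₁ j)))))

      rowC-inject₁ : ∀ u j → rowC u (inject₁ j) ≡ u (suc j)
      rowC-inject₁ u j = trans (sumF-cong {suc d} λ i → cong (u i *_) (C-inject₁ i j)) (sumF-*idMat u (suc j))

      rowC-last : ∀ u → rowC u (fromℕ d) ≡ - (aₙ ⁻¹) * sumF (λ i → a (inject₁ i) * u i)
      rowC-last u = trans
        (sumF-cong {suc d} λ i → trans (cong (u i *_) (C-last i))
          (solve 3 (λ u a b → u :* (:- (a :* b)) := :- b :* (a :* u)) refl (u i) _ _))
        (sumF-*ˡ (- (aₙ ⁻¹)) (λ i → a (inject₁ i) * u i))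

      U : F → F → ℕ → F
      U μ x i = μ ⟦ i ⟧ * iter σ i x

      U-suc : ∀ μ x i → U μ x (suc i) ≡ μ * σ (U μ x i)
      U-suc μ x i = trans (*-congʳ (⟦⟧-suc μ i)) (trans (*-assoc _ _ _) (*-congˡ (sym (σ-* _ _))))

      U-0 : ∀ μ x → U μ x 0 ≡ x
      U-0 μ x = *-identityˡ x

      vec : F → F → Vec' (suc d)
      vec μ x i = U μ x (toℕ i)

      L : F → F → F
      L μ x = sumF (λ i → a i * U μ x (toℕ i))

      private
        L-split : ∀ μ x → L μ x ≡ sumF (λ i → a (inject₁ i) * vec μ x i) + aₙ * U μ x (suc d)
        L-split μ x = trans (sumF-last (λ i → a i * U μ x (toℕ i))) (cong₂ _+_
          (sumF-cong {suc d} λ i → cong (λ k → a (inject₁ i) * U μ x k) (toℕ-inject₁ i))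
          (cong (λ k → aₙ * U μ x k) (toℕ-fromℕ (suc d))))

        last-eq : ∀ μ x → μ * σ (vec μ x (fromℕ d)) ≡ U μ x (suc d)
        last-eq μ x = trans (cong (λ k → μ * σ (U μ x k)) (toℕ-fromℕ d)) (sym (U-suc μ x d))

      TwistedFixed : F → Vec' (suc d) → Set
      TwistedFixed μ u = ∀ j → rowC u j ≡ μ * σ (u j)

      -- The columns before the last only shift, and there the recursion `U-suc` is all that is
      -- asked. The last column is L_μ(x) = 0 solved for its top term.
      root⇒fixed : ∀ μ x → L μ x ≡ 0# → TwistedFixed μ (vec μ x)
      root⇒fixed μ x Lx≡0 j with view j
      ... | ‵inject₁ j′ = trans (rowC-inject₁ (vec μ x) j′)
        (trans (U-suc μ x (toℕ j′)) (cong (λ k → μ * σ (U μ x k)) (sym (toℕ-inject₁ j′))))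
      ... | ‵fromℕ = begin
        rowC (vec μ x) (fromℕ d)     ≡⟨ rowC-last (vec μ x) ⟩
        - (aₙ ⁻¹) * s                  ≡⟨ solve 4 (λ b s a u → :- b :* s := b :* a :* u :- b :* (s :+ a :* u)) refl (aₙ ⁻¹) s aₙ u ⟩
        aₙ ⁻¹ * aₙ * u + - (aₙ ⁻¹ * (s + aₙ * u))
          ≡⟨ cong₂ (λ p q → p * u + - (aₙ ⁻¹ * q)) (inverseˡ aₙ≢0) (trans (sym (L-split μ x)) Lx≡0) ⟩
        1# * u + - (aₙ ⁻¹ * 0#)      ≡⟨ solve 2 (λ u b → con (1 , 0) :* u :- b :* con (0 , 0) := u) refl u (aₙ ⁻¹) ⟩
        u                            ≡⟨ last-eq μ x ⟨
        μ * σ (vec μ x (fromℕ d))    ∎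
        where
        open ≡-Reasoning
        s u : F
        s = sumF (λ i → a (inject₁ i) * vec μ x i)
        u = U μ x (suc d)

      fixed⇒vec : ∀ {μ u} → TwistedFixed μ u → ∀ j → u j ≡ vec μ (u zero) j
      fixed⇒vec {μ} {u} fixed j = go (toℕ j) j refl
        where
        go : ∀ k j → toℕ j ≡ k → u j ≡ U μ (u zero) k
        go zero zero eq = sym (U-0 μ (u zero))
        go (suc k) (suc j) eq = begin
          u (suc j)                  ≡⟨ rowC-inject₁ u j ⟨
          rowC u (inject₁ j)         ≡⟨ fixed (inject₁ j) ⟩
          μ * σ (u (inject₁ j))      ≡⟨ cong (λ z → μ * σ z) (go k (inject₁ j) (trans (toℕ-inject₁ j) (ℕₚ.suc-injective eq))) ⟩
          μ * σ (U μ (u zero) k)     ≡⟨ U-suc μ (u zero) k ⟨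
          U μ (u zero) (suc k)       ∎
          where open ≡-Reasoning

      fixed⇒root : ∀ {μ u} → TwistedFixed μ u → L μ (u zero) ≡ 0#
      fixed⇒root {μ} {u} fixed = begin
        L μ x                                ≡⟨ L-split μ x ⟩
        s + aₙ * U μ x (suc d)               ≡⟨ cong (λ z → s + aₙ * z) (last-eq μ x) ⟨
        s + aₙ * (μ * σ (vec μ x (fromℕ d))) ≡⟨ cong (λ z → s + aₙ * (μ * σ z)) (fixed⇒vec fixed (fromℕ d)) ⟨
        s + aₙ * (μ * σ (u (fromℕ d)))       ≡⟨ cong (λ z → s + aₙ * z) (trans (sym (fixed (fromℕ d))) (rowC-last u)) ⟩
        s + aₙ * (- (aₙ ⁻¹) * sumF (λ i → a (inject₁ i) * u i))
          ≡⟨ cong (λ z → s + aₙ * (- (aₙ ⁻¹) * z)) (sumF-cong {suc d} λ i → cong (a (inject₁ i) *_) (fixed⇒vec fixed i)) ⟩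
        s + aₙ * (- (aₙ ⁻¹) * s)               ≡⟨ solve 3 (λ s a b → s :+ a :* (:- b :* s) := s :- a :* b :* s) refl s aₙ (aₙ ⁻¹) ⟩
        s + - (aₙ * aₙ ⁻¹ * s)               ≡⟨ cong (λ z → s + - (z * s)) (inverse aₙ aₙ≢0) ⟩
        s + - (1# * s)                       ≡⟨ solve 1 (λ s → s :- con (1 , 0) :* s := con (0 , 0)) refl s ⟩
        0#                                   ∎
        where
        open ≡-Reasoning
        x s : F
        x = u zero
        s = sumF (λ i → a (inject₁ i) * vec μ x i)

      private
        P : ℕ → Mat (suc d)
        P m = prodTwisted σ C m

        row-P-suc : ∀ m (u : Vec' (suc d)) j →
          sumF (λ k → u k * P (suc m) k j) ≡ sumF (λ l → sumF (λ k → u k * P m k l) * iter σ m (C l j))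
        row-P-suc m u j = sym (sumF-assoc u (P m) (λ l → iter σ m (C l j)))

        -- Applying σ^m to u C = μ u^σ shows that each further factor of the product sends u^(σ^m)
        -- to σ^m(μ) u^(σ^(m+1)); the scalars accumulate to μ^[m].
        row-P-fixed : ∀ {μ u} → TwistedFixed μ u → ∀ m j →
          sumF (λ k → u k * P m k j) ≡ μ ⟦ m ⟧ * iter σ m (u j)
        row-P-fixed {μ} {u} fixed zero j = trans (sumF-*idMat u j) (sym (*-identityˡ _))
        row-P-fixed {μ} {u} fixed (suc m) j = begin
          sumF (λ k → u k * P (suc m) k j)
            ≡⟨ row-P-suc m u j ⟩
          sumF (λ l → sumF (λ k → u k * P m k l) * iter σ m (C l j))
            ≡⟨ sumF-cong {suc d} (λ l → trans (*-congʳ (row-P-fixed fixed m l))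
                 (trans (*-assoc _ _ _) (*-congˡ (sym (σ^-* m (u l) (C l j)))))) ⟩
          sumF (λ l → μ ⟦ m ⟧ * iter σ m (u l * C l j))
            ≡⟨ sumF-*ˡ (μ ⟦ m ⟧) (λ l → iter σ m (u l * C l j)) ⟩
          μ ⟦ m ⟧ * sumF (λ l → iter σ m (u l * C l j))
            ≡⟨ *-congˡ (trans (sym (σ^-sumF m (λ l → u l * C l j))) (cong (iter σ m) (fixed j))) ⟩
          μ ⟦ m ⟧ * iter σ m (μ * σ (u j))
            ≡⟨ *-congˡ (trans (σ^-* m _ _) (*-congˡ (sym (iter-suc σ m (u j))))) ⟩
          μ ⟦ m ⟧ * (iter σ m μ * iter σ (suc m) (u j))
            ≡⟨ trans (sym (*-assoc _ _ _)) (*-congʳ (sym (⟦⟧-snoc μ m))) ⟩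
          μ ⟦ suc m ⟧ * iter σ (suc m) (u j)  ∎
          where open ≡-Reasoning

      fixed⇒eigenvector : ∀ {μ u} → TwistedFixed μ u → InLeftEig A (N μ) u
      fixed⇒eigenvector {μ} {u} fixed j = trans (row-P-fixed fixed n j) (*-congˡ (σ^n (u j)))

      -- The semilinear operator whose powers recover A

      -- The scalar is a parameter because two values occur: ν = μ⁻¹ for descent on an eigenspace,
      -- and ν = 1 for the injectivity of A.
      T : F → Vec' (suc d) → Vec' (suc d)
      T ν u j = τ (ν * rowC u j)

      T-semilinear : ∀ ν → IsSemilinear τ (T ν)
      T-semilinear ν = record
        { S-cong = λ v≡w j → cong (λ z → τ (ν * z)) (sumF-cong {suc d} λ k → cong (_* C k j) (v≡w k))
        ; S-add = λ v w j → trans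
            (cong τ (trans (*-congˡ (trans (sumF-cong {suc d} λ k → distribʳ (C k j) (v k) (w k)) (sumF-+ (λ k → v k * C k j) (λ k → w k * C k j))))
              (distribˡ _ _ _)))
            (σ^-+ (ℕ.pred n) _ _)
        ; S-scale = λ c v j → trans
            (cong τ (trans (*-congˡ (trans (sumF-cong {suc d} λ k → *-assoc c (v k) (C k j)) (sumF-*ˡ c (λ k → v k * C k j))))
              (solve 3 (λ a b c → a :* (b :* c) := b :* (a :* c)) refl ν c _)))
            (τ-* _ _)
        }

      -- Applying σ^k clears the k inverse automorphisms inside T^k and leaves the twisted partial
      -- product of conjugates of C. At k = n the power of σ disappears and the product is A.
      σ^T^ : ∀ ν u k j → iter σ k (iterV (T ν) k u j) ≡ ν ⟦ k ⟧ * sumF (λ i → u i * P k i j)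
      σ^T^ ν u zero j = sym (trans (*-identityˡ _) (sumF-*idMat u j))
      σ^T^ ν u (suc k) j = begin
        iter σ (suc k) (τ (ν * rowC w j))        ≡⟨ trans (iter-suc σ k _) (cong (iter σ k) (στ _)) ⟩
        iter σ k (ν * rowC w j)                  ≡⟨ trans (σ^-* k _ _) (*-congˡ (σ^-sumF k (λ l → w l * C l j))) ⟩
        iter σ k ν * sumF (λ l → iter σ k (w l * C l j))
          ≡⟨ *-congˡ (sumF-cong {suc d} λ l → trans (σ^-* k (w l) (C l j)) (trans (*-congʳ (σ^T^ ν u k l)) (*-assoc _ _ _))) ⟩
        iter σ k ν * sumF (λ l → ν ⟦ k ⟧ * (sumF (λ i → u i * P k i l) * iter σ k (C l j)))
          ≡⟨ *-congˡ (sumF-*ˡ (ν ⟦ k ⟧) (λ l → sumF (λ i → u i * P k i l) * iter σ k (C l j))) ⟩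
        iter σ k ν * (ν ⟦ k ⟧ * sumF (λ l → sumF (λ i → u i * P k i l) * iter σ k (C l j)))
          ≡⟨ solve 3 (λ a b c → a :* (b :* c) := b :* a :* c) refl _ (ν ⟦ k ⟧) _ ⟩
        ν ⟦ k ⟧ * iter σ k ν * sumF (λ l → sumF (λ i → u i * P k i l) * iter σ k (C l j))
          ≡⟨ cong₂ _*_ (sym (⟦⟧-snoc ν k)) (sym (row-P-suc k u j)) ⟩
        ν ⟦ suc k ⟧ * sumF (λ i → u i * P (suc k) i j)  ∎
        where
        open ≡-Reasoning
        w : Vec' (suc d)
        w = iterV (T ν) k u

      eigenvector⇒T^n-fixed : ∀ {μ u} → μ ≢ 0# → InLeftEig A (N μ) u → ∀ j → iterV (T (μ ⁻¹)) n u j ≡ u j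
      eigenvector⇒T^n-fixed {μ} {u} μ≢0 eig j = begin
        iterV (T (μ ⁻¹)) n u j             ≡⟨ σ^n _ ⟨
        iter σ n (iterV (T (μ ⁻¹)) n u j)  ≡⟨ σ^T^ (μ ⁻¹) u n j ⟩
        N (μ ⁻¹) * sumF (λ i → u i * A i j) ≡⟨ *-congˡ (eig j) ⟩
        N (μ ⁻¹) * (N μ * u j)             ≡⟨ trans (sym (*-assoc _ _ _)) (*-congʳ (sym (⟦⟧-* _ _ n))) ⟩
        N (μ ⁻¹ * μ) * u j                 ≡⟨ *-congʳ (trans (cong N (inverseˡ μ≢0)) (⟦⟧-1 n)) ⟩
        1# * u j                           ≡⟨ *-identityˡ _ ⟩
        u j                                ∎
        where open ≡-Reasoning

      T-fixed⇒fixed : ∀ {μ u} → μ ≢ 0# → (∀ j → T (μ ⁻¹) u j ≡ u j) → TwistedFixed μ u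
      T-fixed⇒fixed {μ} {u} μ≢0 Tu≡u j = begin
        rowC u j                    ≡⟨ *-identityˡ _ ⟨
        1# * rowC u j               ≡⟨ *-congʳ (sym (inverse μ μ≢0)) ⟩
        μ * μ ⁻¹ * rowC u j         ≡⟨ *-assoc _ _ _ ⟩
        μ * (μ ⁻¹ * rowC u j)       ≡⟨ *-congˡ (στ _) ⟨
        μ * σ (T (μ ⁻¹) u j)        ≡⟨ *-congˡ (cong σ (Tu≡u j)) ⟩
        μ * σ (u j)                 ∎
        where open ≡-Reasoning

      private
        -- The shift columns kill every coordinate except the first; the last column then reads a₀
        -- u₀ = 0.
        rowC-injective : ∀ {u} → (∀ j → rowC u j ≡ 0#) → ∀ j → u j ≡ 0#
        rowC-injective {u} uC≡0 = λ { zero → u₀≡0 ; (suc j) → u₊≡0 j }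
          where
          u₊≡0 : ∀ j → u (suc j) ≡ 0#
          u₊≡0 j = trans (sym (rowC-inject₁ u j)) (uC≡0 (inject₁ j))
          s≡0 : sumF (λ i → a (inject₁ i) * u i) ≡ 0#
          s≡0 = x*y≡0⇒y≡0 (⁻¹-≢0 aₙ≢0) (begin
            aₙ ⁻¹ * s          ≡⟨ solve 2 (λ b s → b :* s := :- (:- b :* s)) refl (aₙ ⁻¹) s ⟩
            - (- (aₙ ⁻¹) * s)    ≡⟨ cong -_ (trans (sym (rowC-last u)) (uC≡0 (fromℕ d))) ⟩
            - 0#               ≡⟨ -0#≈0# ⟩
            0#                 ∎)
            where
            open ≡-Reasoning
            s : F
            s = sumF (λ i → a (inject₁ i) * u i)
          u₀≡0 : u zero ≡ 0#
          u₀≡0 = x*y≡0⇒y≡0 a₀≢0 (begin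
            a zero * u zero           ≡⟨ +-identityʳ _ ⟨
            a zero * u zero + 0#      ≡⟨ +-congˡ (sumF-zero {d} (λ i → trans (*-congˡ (u₊≡0 i)) (zeroʳ _))) ⟨
            sumF (λ i → a (inject₁ i) * u i)  ≡⟨ s≡0 ⟩
            0#                        ∎)
            where open ≡-Reasoning

        T-injective : ∀ {u} → (∀ j → T 1# u j ≡ 0#) → ∀ j → u j ≡ 0#
        T-injective {u} Tu≡0 = rowC-injective λ j → begin
          rowC u j             ≡⟨ *-identityˡ _ ⟨
          1# * rowC u j        ≡⟨ στ _ ⟨
          σ (T 1# u j)         ≡⟨ trans (cong σ (Tu≡0 j)) σ-0 ⟩
          0#                   ∎
          where open ≡-Reasoning

        T^-injective : ∀ k {u} → (∀ j → iterV (T 1#) k u j ≡ 0#) → ∀ j → u j ≡ 0#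
        T^-injective zero h = h
        T^-injective (suc k) h = T^-injective k (T-injective h)

      -- A need not be inverted: u A = 0 makes the n-th power of `T 1#` vanish at u, and each
      -- application of `T 1#` is injective.
      A-injective : ∀ {u} → InLeftEig A 0# u → ∀ j → u j ≡ 0#
      A-injective {u} uA≡0 = T^-injective n λ j → begin
        iterV (T 1#) n u j                  ≡⟨ σ^n _ ⟨
        iter σ n (iterV (T 1#) n u j)       ≡⟨ σ^T^ 1# u n j ⟩
        N 1# * sumF (λ i → u i * A i j)     ≡⟨ *-congˡ (trans (uA≡0 j) (zeroˡ _)) ⟩
        N 1# * 0#                           ≡⟨ zeroʳ _ ⟩
        0#                                  ∎
        where open ≡-Reasoning

      -- The number of roots of L_μ as a power of q

      U-span : ∀ {r} μ (c x : Fin r → F) → (∀ j → InFq (c j)) → ∀ i →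
        U μ (sumF (λ j → c j * x j)) i ≡ sumF (λ j → c j * U μ (x j) i)
      U-span {r} μ c x c∈ i = begin
        μ ⟦ i ⟧ * iter σ i (sumF (λ j → c j * x j))
          ≡⟨ *-congˡ (σ^-sumF i (λ j → c j * x j)) ⟩
        μ ⟦ i ⟧ * sumF (λ j → iter σ i (c j * x j))
          ≡⟨ sumF-*ˡ (μ ⟦ i ⟧) (λ j → iter σ i (c j * x j)) ⟨
        sumF (λ j → μ ⟦ i ⟧ * iter σ i (c j * x j))
          ≡⟨ sumF-cong {r} (λ j → trans
               (*-congˡ (trans (σ^-* i (c j) (x j)) (*-congʳ (iter-fixed (Fq⇒fixed (c∈ j)) i))))
               (solve 3 (λ m c y → m :* (c :* y) := c :* (m :* y)) refl (μ ⟦ i ⟧) (c j) (iter σ i (x j)))) ⟩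
        sumF (λ j → c j * U μ (x j) i)  ∎
        where open ≡-Reasoning

      L-span : ∀ {r} μ (c x : Fin r → F) → (∀ j → InFq (c j)) →
        L μ (sumF (λ j → c j * x j)) ≡ sumF (λ j → c j * L μ (x j))
      L-span {r} μ c x c∈ = begin
        sumF (λ i → a i * U μ (sumF (λ j → c j * x j)) (toℕ i))
          ≡⟨ sumF-cong {suc (suc d)} (λ i → trans (cong (a i *_) (U-span μ c x c∈ (toℕ i))) (*-comm (a i) _)) ⟩
        sumF (λ i → sumF (λ j → c j * U μ (x j) (toℕ i)) * a i)
          ≡⟨ sumF-assoc c (λ j i → U μ (x j) (toℕ i)) a ⟩
        sumF (λ j → c j * sumF (λ i → U μ (x j) (toℕ i) * a i))
          ≡⟨ sumF-cong {r} (λ j → *-congˡ (dot-comm (λ i → U μ (x j) (toℕ i)) a)) ⟩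
        sumF (λ j → c j * L μ (x j))  ∎
        where open ≡-Reasoning

      -- In a normalised relation e, applying the semilinear map and subtracting
      -- leaves a shorter one, so e has coefficients in the fixed field.
      vec-indep : ∀ {r μ} {x : Fin r → F} → μ ≢ 0# → (∀ j → L μ (x j) ≡ 0#) → FqIndep x → LinIndep (vec μ ∘ x)
      vec-indep {zero} μ≢0 roots ind c rel ()
      vec-indep {suc r} {μ} {x} μ≢0 roots ind c rel = conclude
        where
        open ≡-Reasoning
        tail-indep : LinIndep (vec μ ∘ x ∘ suc)
        tail-indep = vec-indep μ≢0 (roots ∘ suc) λ c′ c′∈ rel′ i →
          ind (snoc 0# c′) (λ { zero → 0∈Fq ; (suc i) → c′∈ i })
            (trans (+-congʳ (zeroˡ _)) (trans (+-identityˡ _) rel′)) (suc i)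
        module _ (e : Fin (suc r) → F) (e₀≡1 : e zero ≡ 1#)
          (e-rel : ∀ i → sumF (λ j → e j * vec μ (x j) i) ≡ 0#) where
          σ-rel : ∀ i → sumF (λ j → σ (e j) * σ (vec μ (x j) i)) ≡ 0#
          σ-rel i = trans (sym (trans (σ^-sumF 1 (λ j → e j * vec μ (x j) i)) (sumF-cong {suc r} λ j → σ-* (e j) (vec μ (x j) i))))
            (trans (cong σ (e-rel i)) σ-0)
          -- Multiplying the relation by C replaces each vector v by μ v^σ but leaves the
          -- coefficients alone, whereas `σ-rel` conjugates both.
          C-rel : ∀ i → sumF (λ j → e j * σ (vec μ (x j) i)) ≡ 0#
          C-rel i = x*y≡0⇒y≡0 μ≢0 (begin
            μ * sumF (λ j → e j * σ (vec μ (x j) i))     ≡⟨ sumF-*ˡ μ (λ j → e j * σ (vec μ (x j) i)) ⟨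
            sumF (λ j → μ * (e j * σ (vec μ (x j) i)))
              ≡⟨ sumF-cong {suc r} (λ j → trans (solve 3 (λ m e v → m :* (e :* v) := e :* (m :* v)) refl μ (e j) (σ (vec μ (x j) i)))
                   (*-congˡ (sym (root⇒fixed μ (x j) (roots j) i)))) ⟩
            sumF (λ j → e j * rowC (vec μ (x j)) i)      ≡⟨ sumF-assoc e (λ j → vec μ (x j)) (λ k → C k i) ⟨
            sumF (λ k → sumF (λ j → e j * vec μ (x j) k) * C k i)
              ≡⟨ sumF-zero {suc d} (λ k → trans (cong (_* C k i) (e-rel k)) (zeroˡ _)) ⟩
            0#                                           ∎)
          -- The two relations differ by Σ (e_j - σ(e_j)) σ(v_j) = 0, and the term at 0 drops out
          -- since e₀ = 1. Pulling σ out of the sum, which turns e_j into τ(e_j), gives a relation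
          -- among the shorter family itself.
          difference : ∀ i → sumF (λ j → (τ (e (suc j)) + - e (suc j)) * vec μ (x (suc j)) i) ≡ 0#
          difference i = σ-injective (begin
            σ (sumF (λ j → (τ (e (suc j)) + - e (suc j)) * v j))
              ≡⟨ σ^-sumF 1 (λ j → (τ (e (suc j)) + - e (suc j)) * v j) ⟩
            sumF (λ j → σ ((τ (e (suc j)) + - e (suc j)) * v j))
              ≡⟨ sumF-cong {r} (λ j → trans (σ-* _ _) (*-congʳ (trans (σ-+ _ _) (cong₂ _+_ (στ _) (σ-neg _))))) ⟩
            sumF (λ j → (e (suc j) + - σ (e (suc j))) * σ (v j))
              ≡⟨ +-identityˡ _ ⟨
            0# + sumF (λ j → (e (suc j) + - σ (e (suc j))) * σ (v j))
              ≡⟨ +-congʳ (trans (*-congʳ (trans (cong (λ z → z + - σ z) e₀≡1) (x≡y⇒x-y≡0 (sym σ-1)))) (zeroˡ _)) ⟨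
            sumF (λ j → (e j + - σ (e j)) * σ (vec μ (x j) i))
              ≡⟨ sumF-cong {suc r} (λ j → solve 3 (λ e s v → (e :- s) :* v := e :* v :+ :- (s :* v)) refl (e j) (σ (e j)) (σ (vec μ (x j) i))) ⟩
            sumF (λ j → e j * σ (vec μ (x j) i) + - (σ (e j) * σ (vec μ (x j) i)))
              ≡⟨ trans (sumF-+ (λ j → e j * σ (vec μ (x j) i)) (λ j → - (σ (e j) * σ (vec μ (x j) i)))) (+-congˡ (sumF-neg (λ j → σ (e j) * σ (vec μ (x j) i)))) ⟩
            sumF (λ j → e j * σ (vec μ (x j) i)) + - sumF (λ j → σ (e j) * σ (vec μ (x j) i))
              ≡⟨ x≡y⇒x-y≡0 (trans (C-rel i) (sym (σ-rel i))) ⟩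
            0#  ≡⟨ σ-0 ⟨
            σ 0# ∎)
            where
            v : Fin r → F
            v j = vec μ (x (suc j)) i
          e∈Fq : ∀ j → InFq (e j)
          e∈Fq zero = subst InFq (sym e₀≡1) 1∈Fq
          e∈Fq (suc j) = fixed⇒Fq (trans (cong σ (sym (x-y≡0⇒x≡y (tail-indep _ difference j)))) (στ _))
          absurd : 1# ≡ 0#
          absurd = trans (sym e₀≡1) (ind e e∈Fq
            (trans (sumF-cong {suc r} λ j → cong (e j *_) (sym (U-0 μ (x j)))) (e-rel zero)) zero)
        conclude : ∀ j → c j ≡ 0#
        conclude with c zero ≟F 0#
        ... | yes c₀≡0 = λ { zero → c₀≡0 ; (suc j) → tail-indep (c ∘ suc)
                (λ i → trans (sym (trans (+-congʳ (trans (*-congʳ c₀≡0) (zeroˡ _))) (+-identityˡ _))) (rel i)) j }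
        ... | no c₀≢0 = ⊥-elim (1≢0 (absurd (λ j → c zero ⁻¹ * c j) (inverseˡ c₀≢0) λ i → begin
                sumF (λ j → c zero ⁻¹ * c j * vec μ (x j) i)    ≡⟨ sumF-cong {suc r} (λ j → *-assoc (c zero ⁻¹) (c j) (vec μ (x j) i)) ⟩
                sumF (λ j → c zero ⁻¹ * (c j * vec μ (x j) i))  ≡⟨ sumF-*ˡ (c zero ⁻¹) (λ j → c j * vec μ (x j) i) ⟩
                c zero ⁻¹ * sumF (λ j → c j * vec μ (x j) i)    ≡⟨ trans (*-congˡ (rel i)) (zeroʳ _) ⟩
                0#                                              ∎))

      span-isSubspace : ∀ {r k} (fs : Fin r → Vec' k) → IsSubspace (λ v → ∃ λ e → ∀ i → v i ≡ sumF (λ j → e j * fs j i))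
      span-isSubspace {r} fs = record
        { resp = λ v≡w (e , v≡) → e , λ i → trans (sym (v≡w i)) (v≡ i)
        ; add = λ (e , v≡) (e′ , w≡) → (λ j → e j + e′ j) , λ i → trans (cong₂ _+_ (v≡ i) (w≡ i))
            (trans (sym (sumF-+ (λ j → e j * fs j i) (λ j → e′ j * fs j i))) (sumF-cong {r} λ j → sym (distribʳ (fs j i) (e j) (e′ j))))
        ; scale = λ c (e , v≡) → (λ j → c * e j) , λ i → trans (*-congˡ (v≡ i))
            (trans (sym (sumF-*ˡ c (λ j → e j * fs j i))) (sumF-cong {r} λ j → sym (*-assoc c (e j) (fs j i))))
        }

      -- For an F_q-basis of r roots, r ≤ m because its vectors are independent left eigenvectors,
      -- and m ≤ r because by descent they span the left eigenspace.
      #roots-L : ∀ {μ m} → μ ≢ 0# → EigDim A (N μ) m → countRoots (L μ) ≡ q ℕ.^ m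
      #roots-L {μ} {m} μ≢0 ((vs , vs-eig , vs-ind) , maximal) with basis (filter (λ x → L μ x ≟F 0#) elements)
      ... | r , x , x∈ , ind , spans = trans
        (#span ind (Unique.filter⁺ root? unique) spans span⇒root)
        (cong (q ℕ.^_) (ℕₚ.≤-antisym r≤m m≤r))
        where
        root? : ∀ x → Dec (L μ x ≡ 0#)
        root? x = L μ x ≟F 0#
        roots : ∀ j → L μ (x j) ≡ 0#
        roots j = proj₂ (∈-filter⁻ root? {xs = elements} (x∈ j))
        span⇒root : ∀ {y} → FqSpan x y → y ∈ filter root? elements
        span⇒root (c , c∈ , y≡) = ∈-filter⁺ root? (complete _)
          (trans (cong (L μ) y≡) (trans (L-span μ c x c∈) (sumF-zero {r} λ j → trans (*-congˡ (roots j)) (zeroʳ _))))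
        r≤m : r ≤ m
        -- `m<r` means `suc m` ≤ r, so exactly m + 1 right eigenvectors are extracted, the number
        -- that `maximal` rules out.
        r≤m = ℕₚ.≮⇒≥ λ m<r →
          let ws , ws-ind , ws-eig = left⇒right-eigenvectors {A = A} (vec-indep μ≢0 roots ind)
                (λ j → fixed⇒eigenvector (root⇒fixed μ (x j) (roots j))) m<r
          in maximal ws ws-eig ws-ind
        m≤r : m ≤ r
        m≤r =
          let us , us-ind , us-eig = right⇒left-eigenvectors {A = A} {vs = vs} vs-ind vs-eig
              spanned : ∀ j → ∃ λ e → ∀ i → us j i ≡ sumF (λ k → e k * vec μ (x k) i)
              spanned j = descent {n = n} τ-* τ-moves (span-isSubspace (vec μ ∘ x)) 1≤n τ^n
                (T-semilinear (μ ⁻¹)) fixed∈span (us j) (eigenvector⇒T^n-fixed μ≢0 (us-eig j))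
          in indep⇒≤span (vec μ ∘ x) (λ j → proj₁ (spanned j)) us-ind (λ j → proj₂ (spanned j))
          where
          -- A fixed vector is determined by its first coordinate, a root of L_μ. The
          -- F_q-coefficients of that root serve in every coordinate, since σ fixes them.
          fixed∈span : ∀ t → (∀ i → T (μ ⁻¹) t i ≡ t i) → ∃ λ e → ∀ i → t i ≡ sumF (λ k → e k * vec μ (x k) i)
          fixed∈span t Tt≡t with spans (∈-filter⁺ root? (complete (t zero)) (fixed⇒root (T-fixed⇒fixed μ≢0 Tt≡t)))
          ... | c , c∈ , t₀≡ = c , λ i → trans (fixed⇒vec (T-fixed⇒fixed μ≢0 Tt≡t) i)
            (trans (cong (λ y → U μ y (toℕ i)) t₀≡) (U-span μ c x c∈ (toℕ i)))

      -- Counting the roots of P_L and of L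

      projPoly-* : ∀ {y μ x} → y * x ≡ μ * σ x → projPoly σ (suc d) a y * x ≡ L μ x
      projPoly-* {y} {μ} {x} eq = trans (sym (sumF-*ʳ (λ i → a i * y ⟦ toℕ i ⟧) x))
        (sumF-cong {suc (suc d)} λ i → trans (*-assoc (a i) _ x) (*-congˡ (twisted-⟦⟧ eq (toℕ i))))

      -- Needed because the substitution y = μ σ(x)/x sends μ = 0 to y = 0, which must not be a root
      -- if only μ ≠ 0 is to be counted.
      projPoly-0 : projPoly σ (suc d) a 0# ≡ a zero
      projPoly-0 = trans (+-congˡ (sumF-zero {suc d} λ i → trans (cong (a (suc i) *_) (zeroˡ (prodF {toℕ i} (λ j → iter σ (suc (toℕ j)) 0#)))) (zeroʳ (a (suc i)))))
        (trans (+-identityʳ _) (*-identityʳ _))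

      linPoly≡L1 : ∀ x → linPoly σ (suc d) a x ≡ L 1# x
      linPoly≡L1 x = sumF-cong {suc (suc d)} λ i → cong (a i *_) (sym (trans (*-congʳ (⟦⟧-1 (toℕ i))) (*-identityˡ (iter σ (toℕ i) x))))

      module _ (nλ : F → ℕ) (eigDim : ∀ λ' → InFq λ' → EigDim A λ' (nλ λ')) where

        g : F → ℕ
        g λ' = gauss q (nλ λ')

        -- The sum runs over all of F_q, but the double count only sees norms of nonzero μ; the term
        -- at 0 has to vanish on its own.
        n₀≡0 : nλ 0# ≡ 0
        n₀≡0 with nλ 0# | eigDim 0# 0∈Fq
        ... | zero | _ = refl
        ... | suc m | (vs , vs-eig , vs-ind) , _ =
          let us , us-ind , us-eig = right⇒left-eigenvectors {A = A} {vs = vs} vs-ind vs-eig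
          in ⊥-elim (1≢0 (us-ind (λ _ → 1#) (λ i → sumF-zero {suc m} λ j → trans (cong (1# *_) (A-injective (us-eig j) i)) (zeroʳ 1#)) zero))

        gauss-0 : ∀ q → gauss q 0 ≡ 0
        gauss-0 zero = refl
        gauss-0 (suc zero) = refl
        gauss-0 (suc (suc _)) = refl

        g-0 : g 0# ≡ 0
        g-0 = trans (cong (gauss q) n₀≡0) (gauss-0 q)

        -- The root 0 accounts for the 1 in q^m = 1 + `gauss q m` · (q - 1), so the count is done
        -- after adding 1 to both sides.
        #nonzero-roots-L : ∀ {μ} → μ ≢ 0# → ∑ (λ x → nz x ℕ.* 𝟙 (L μ x ≟F 0#)) elements ≡ g (N μ) ℕ.* k
        #nonzero-roots-L {μ} μ≢0 = ℕₚ.suc-injective (begin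
          1 ℕ.+ ∑ (λ x → nz x ℕ.* r x) elements
            ≡⟨ cong (ℕ._+ ∑ (λ x → nz x ℕ.* r x) elements)
                 (trans (sym (𝟙-yes (L μ 0# ≟F 0#) L0≡0)) (sym (∑-𝟙-* _≟F_ r unique (complete 0#)))) ⟩
          ∑ (λ x → 𝟙 (x ≟F 0#) ℕ.* r x) elements ℕ.+ ∑ (λ x → nz x ℕ.* r x) elements
            ≡⟨ ∑-+ (λ x → 𝟙 (x ≟F 0#) ℕ.* r x) (λ x → nz x ℕ.* r x) elements ⟨
          ∑ (λ x → 𝟙 (x ≟F 0#) ℕ.* r x ℕ.+ nz x ℕ.* r x) elements
            ≡⟨ ∑-cong elements (λ x → trans (sym (ℕₚ.*-distribʳ-+ (r x) (𝟙 (x ≟F 0#)) (nz x)))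
                 (trans (cong (ℕ._* r x) (𝟙-¬ (x ≟F 0#))) (ℕₚ.*-identityˡ (r x)))) ⟩
          ∑ r elements                 ≡⟨ countRoots-∑ (L μ) ⟨
          countRoots (L μ)             ≡⟨ #roots-L μ≢0 (eigDim (N μ) (N∈Fq μ≢0)) ⟩
          q ℕ.^ nλ (N μ)               ≡⟨ gauss-spec 1<q (nλ (N μ)) ⟩
          suc (g (N μ) ℕ.* k)          ∎)
          where
          open ≡-Reasoning
          r : F → ℕ
          r x = 𝟙 (L μ x ≟F 0#)
          L0≡0 : L μ 0# ≡ 0#
          L0≡0 = sumF-zero {suc (suc d)} λ i → trans (cong (a i *_) (trans (*-congˡ (σ^-0 (toℕ i))) (zeroʳ (μ ⟦ toℕ i ⟧)))) (zeroʳ (a i))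

        Z : ℕ
        Z = countRoots (projPoly σ (suc d) a)

        -- y = μ σ(x) / x is a root of P_L exactly when x is a root of L_μ.
        Z-via-L : ∀ {x} → x ≢ 0# → Z ≡ ∑ (λ μ → nz μ ℕ.* 𝟙 (L μ x ≟F 0#)) elements
        Z-via-L {x} x≢0 = trans (countRoots-∑ (projPoly σ (suc d) a)) (trans
          (∑-rescale (λ y → 𝟙 (projPoly σ (suc d) a y ≟F 0#)) (*-≢0 (σ-≢0 x≢0) (⁻¹-≢0 x≢0)))
          (∑-cong elements pointwise))
          where
          c : F
          c = σ x * x ⁻¹
          pointwise : ∀ μ → 𝟙 (projPoly σ (suc d) a (μ * c) ≟F 0#) ≡ nz μ ℕ.* 𝟙 (L μ x ≟F 0#)
          pointwise μ with μ ≟F 0#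
          ... | yes refl = 𝟙-no (projPoly σ (suc d) a (0# * c) ≟F 0#)
            λ root → a₀≢0 (trans (sym projPoly-0) (trans (cong (projPoly σ (suc d) a) (sym (zeroˡ c))) root))
          ... | no _ = trans
            (𝟙-⇔ (projPoly σ (suc d) a (μ * c) ≟F 0#) (L μ x ≟F 0#)
              (λ root → trans (sym Px≡L) (trans (*-congʳ root) (zeroˡ x)))
              λ root → x*y≡0⇒y≡0 x≢0 (trans (*-comm _ _) (trans Px≡L root)))
            (sym (ℕₚ.*-identityˡ _))
            where
            Px≡L : projPoly σ (suc d) a (μ * c) * x ≡ L μ x
            Px≡L = projPoly-* (trans
              (solve 4 (λ m s i x → m :* (s :* i) :* x := m :* s :* (i :* x)) refl μ (σ x) (x ⁻¹) x)
              (trans (*-congˡ (inverseˡ x≢0)) (*-identityʳ _)))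

        -- Every x ≠ 0 sees the same number Z of values μ, so the pairs number `κ` · Z. Counted by μ
        -- and grouped by norm, they number `κ` times the Gaussian sum, because `fibre λ'` · `k` =
        -- `κ`. Cancelling `κ` at the end avoids dividing by q - 1.
        #roots-projPoly : Z ≡ sum (map g Fq)
        #roots-projPoly = ℕₚ.*-cancelˡ-≡ Z (∑ g Fq) κ {{ℕ.≢-nonZero κ≢0}} (begin
          κ ℕ.* Z
            ≡⟨ ∑-*ʳ nz elements Z ⟨
          ∑ (λ x → nz x ℕ.* Z) elements
            ≡⟨ ∑-cong elements (λ x → nz-cong x Z-via-L) ⟩
          ∑ (λ x → nz x ℕ.* ∑ (λ μ → nz μ ℕ.* r μ x) elements) elements
            ≡⟨ ∑-cong elements (λ x → trans (sym (∑-*ˡ (nz x) (λ μ → nz μ ℕ.* r μ x) elements))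
                 (∑-cong elements λ μ → trans (sym (ℕₚ.*-assoc (nz x) (nz μ) (r μ x)))
                   (trans (rearrange (nz x) (nz μ) (r μ x)) (cong (nz μ ℕ.*_) (ℕₚ.*-comm (r μ x) (nz x)))))) ⟩
          ∑ (λ x → ∑ (λ μ → nz μ ℕ.* (nz x ℕ.* r μ x)) elements) elements
            ≡⟨ ∑-swap (λ x μ → nz μ ℕ.* (nz x ℕ.* r μ x)) elements elements ⟩
          ∑ (λ μ → ∑ (λ x → nz μ ℕ.* (nz x ℕ.* r μ x)) elements) elements
            ≡⟨ ∑-cong elements (λ μ → trans (∑-*ˡ (nz μ) (λ x → nz x ℕ.* r μ x) elements)
                 (trans (nz-cong μ #nonzero-roots-L) (cong (nz μ ℕ.*_) (ℕₚ.*-comm _ k)))) ⟩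
          ∑ (λ μ → nz μ ℕ.* (k ℕ.* g (N μ))) elements
            ≡⟨ ∑-fibre-* (λ λ' → k ℕ.* g λ') ⟨
          ∑ (λ λ' → fibre λ' ℕ.* (k ℕ.* g λ')) Fq
            ≡⟨ ∑-cong∈ Fq (λ {λ'} λ∈ → term λ∈) ⟩
          ∑ (λ λ' → κ ℕ.* g λ') Fq
            ≡⟨ ∑-*ˡ κ g Fq ⟩
          κ ℕ.* ∑ g Fq  ∎)
          where
          open ≡-Reasoning
          r : F → F → ℕ
          r μ x = 𝟙 (L μ x ≟F 0#)
          term : ∀ {λ'} → λ' ∈ Fq → fibre λ' ℕ.* (k ℕ.* g λ') ≡ κ ℕ.* g λ'
          term {λ'} λ∈ with λ' ≟F 0#
          ... | no λ≢0 = trans (sym (ℕₚ.*-assoc (fibre λ') k (g λ'))) (cong (ℕ._* g λ') (fibre-size (∈-filter⁺ nonzero? λ∈ λ≢0)))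
          -- `fibre-size` does not cover λ' = 0; here both sides vanish because `g 0#` does.
          ... | yes refl = trans (cong (λ z → fibre 0# ℕ.* (k ℕ.* z)) g-0)
            (trans (cong (fibre 0# ℕ.*_) (ℕₚ.*-zeroʳ k)) (trans (ℕₚ.*-zeroʳ (fibre 0#)) (sym (trans (cong (κ ℕ.*_) g-0) (ℕₚ.*-zeroʳ κ)))))

        #roots-linPoly : countRoots (linPoly σ (suc d) a) ≡ q ℕ.^ nλ 1#
        #roots-linPoly = begin
          countRoots (linPoly σ (suc d) a)   ≡⟨ countRoots-∑ _ ⟩
          ∑ (λ x → 𝟙 (linPoly σ (suc d) a x ≟F 0#)) elements
            ≡⟨ ∑-cong elements (λ x → cong (λ z → 𝟙 (z ≟F 0#)) (linPoly≡L1 x)) ⟩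
          ∑ (λ x → 𝟙 (L 1# x ≟F 0#)) elements  ≡⟨ countRoots-∑ (L 1#) ⟨
          countRoots (L 1#)                  ≡⟨ #roots-L 1≢0 (eigDim (N 1#) (N∈Fq 1≢0)) ⟩
          q ℕ.^ nλ (N 1#)                    ≡⟨ cong (λ z → q ℕ.^ nλ z) (⟦⟧-1 n) ⟩
          q ℕ.^ nλ 1#                        ∎
          where open ≡-Reasoning

theorem6 : (K : FiniteField) → let open FFDefs K in
    (q n s : ℕ) → IsPrimePower q → 1 ≤ n → card ≡ q ^ n → Coprime s n →
    (d : ℕ) → (a : Fin (suc (suc d)) → F) →
    a zero ≢ 0# → a (fromℕ (suc d)) ≢ 0# →
    (nλ : F → ℕ) →
    (∀ λ' → pow λ' q ≡ λ' → EigDim (AL (λ x → pow x (q ^ s)) d a n) λ' (nλ λ')) →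
    (countRoots (projPoly (λ x → pow x (q ^ s)) (suc d) a)
    ≡ sum (map (λ λ' → gauss q (nλ λ')) (filter (λ x → pow x q ≟F x) elements)))
    × (countRoots (linPoly (λ x → pow x (q ^ s)) (suc d) a) ≡ q ^ nλ 1#)
theorem6 K q n s primePower 1≤n card≡ s⊥n d a a₀≢0 aₙ≢0 nλ eigDim =
  #roots-projPoly nλ eigDim , #roots-linPoly nλ eigDim
  where
  open Field K
  1<q : 1 ℕ.< q
  1<q = prime-power>1 primePower
  open Twisted q n 1<q 1≤n card≡
    (Subfield.frobenius-generator q n 1<q 1≤n card≡ s s⊥n (prime-power-freshman {n = n} primePower card≡ s))
  open Companion d a a₀≢0 aₙ≢0
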